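{- Let $\Gamma_0$ and $\Gamma_1$ be any two upward planar drawings of a reduced plane $st$-graph. There is a $3$-step upward planar morph from $\Gamma_0$ to $\Gamma_1$.
   Context: All graphs are finite. All drawings are straight-line: vertices are distinct points of the plane and each edge is the straight-line segment between its end-vertices. A drawing is planar if no two edges intersect (except at common end-vertices). For a directed graph, $uv$ denotes an edge directed from $u$ to $v$ ($v$ is a successor of $u$, and $u$ a predecessor of $v$). A drawing of a directed graph is upward planar if it is planar and each edge $uv$ is monotonically increasing in the $y$-direction from $u$ to $v$; a directed graph is upward planar if it admits such a drawing. In an upward planar drawing, $\mathcal S(v)$ (resp. $\mathcal P(v)$) is the list of the successors (resp. predecessors) of $v$ in left-to-right order around $v$. Two upward planar drawings of a connected directed graph are topologically equivalent if they have the same lists $\mathcal S(v)$ and $\mathcal P(v)$ for each vertex $v$. An upward planar embedding is an equivalence class of upward planar drawings; an upward plane graph is an upward planar graph equipped with an upward planar embedding. Every upward planar drawing of an upward plane graph is assumed to respect its upward planar embedding. A source (sink) is a vertex with no incoming (outgoing) edge. A plane $st$-graph is an upward plane graph with a single source $s$ and a single sink $t$, both incident to the outer face. An edge $uv$ is transitive if the graph contains a directed path from $u$ to $v$ different from the edge $uv$; a directed graph is reduced if it has no transitive edges. A morphing step (or step) is a linear morph $\langle\Gamma,\Gamma'\rangle$: every vertex moves along a straight-line trajectory at uniform speed from its position in $\Gamma$ to its position in $\Gamma'$. A $k$-step morph from $\Gamma_0$ to $\Gamma_1$ is a sequence $\langle\Gamma_0=\Lambda_1,\dots,\Lambda_{k+1}=\Gamma_1\rangle$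 of drawings, consecutive ones being connected by linear morphs. It is an upward planar morph if the drawing at every time instant is an upward planar drawing of the upward plane graph. -}

module Defs where

open import Level using (0ℓ)
open import Algebra.Bundles using (CommutativeRing)
open import Data.Nat.Base using (ℕ; suc)
open import Data.Fin.Base as Fin using (Fin; fromℕ; inject₁)
open import Data.List.Base using (List; []; _∷_)
open import Data.List.Membership.Propositional using (_∈_)
open import Data.List.Relation.Unary.AllPairs using (AllPairs)
open import Data.Product.Base using (∃; ∃-syntax; _×_; proj₁)
open import Data.Sum.Base using (_⊎_)
open import Function.Bundles using (_⇔_)
open import Relation.Binary.Construct.Closure.Equivalence using (EqClosure)
open import Relation.Binary.Construct.Closure.ReflexiveTransitive using (Star)
open import Relation.Binary.Core using (Rel)
open import Relation.Binary.Definitions using (Decidable)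
open import Relation.Binary.PropositionalEquality.Core using (_≡_; _≢_)
open import Relation.Binary.Structures using (IsStrictTotalOrder)
import Relation.Binary.Construct.StrictToNonStrict as StrictToNonStrict
open import Relation.Nullary.Negation.Core using (¬_)

-- The real numbers, axiomatised as a complete ordered field (unique up to
-- isomorphism).  The trichotomous order makes this the classical ℝ.
record RealNumbers : Set₁ where
  field
    commutativeRing : CommutativeRing 0ℓ 0ℓ

  open CommutativeRing commutativeRing public

  infix 4 _<_
  field
    _<_                : Rel Carrier 0ℓ
    isStrictTotalOrder : IsStrictTotalOrder _≈_ _<_

  open StrictToNonStrict _≈_ _<_ public using (_≤_)

  UpperBound : (Carrier → Set) → Carrier → Set
  UpperBound P b = ∀ a → P a → a ≤ b

  field
    0<1      : 0# < 1#
    inverse  : ∀ a → a ≉ 0# → ∃[ b ] a * b ≈ 1#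
    +-mono-< : ∀ a b c → a < b → a + c < b + c
    *-pos    : ∀ a b → 0# < a → 0# < b → 0# < a * b
    supremum : (P : Carrier → Set) → ∃ P → ∃ (UpperBound P) →
               ∃[ s ] UpperBound P s × (∀ b → UpperBound P b → s ≤ b)

-- A relation rather than a multiset of edges: straight-line drawings leave no
-- room for parallel edges.
record Digraph : Set₁ where
  field
    order : ℕ

  Vertex : Set
  Vertex = Fin order

  field
    Edge  : Rel Vertex 0ℓ
    edge? : Decidable Edge

  Connected : Set
  Connected = ∀ u v → EqClosure Edge u v

  Source Sink : Vertex → Set
  Source v = ∀ u → ¬ Edge u v
  Sink   v = ∀ w → ¬ Edge v w

  -- Indexed by the list of visited vertices.  Repetitions need not be
  -- excluded: upward planar graphs are acyclic.
  data Path : Vertex → Vertex → List Vertex → Set where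
    [_] : ∀ v → Path v v (v ∷ [])
    _∷_ : ∀ {u v w vs} → Edge u v → Path v w vs → Path u w (u ∷ vs)

  TransitiveEdge : Rel Vertex 0ℓ
  TransitiveEdge u v = Edge u v × ∃[ vs ] Path u v vs × vs ≢ u ∷ v ∷ []

  Reduced : Set
  Reduced = ∀ u v → ¬ TransitiveEdge u v

module Plane (ℝ : RealNumbers) where

  open RealNumbers ℝ

  record Point : Set where
    constructor ⟨_,_⟩
    field
      x y : Carrier

  open Point public

  infix 4 _≈ₚ_
  _≈ₚ_ : Rel Point 0ℓ
  p ≈ₚ q = (x p ≈ x q) × (y p ≈ y q)

  UnitInterval : Carrier → Set
  UnitInterval t = (0# ≤ t) × (t ≤ 1#)

  interpolate : Point → Point → Carrier → Point
  interpolate p q t = ⟨ (1# - t) * x p + t * x q , (1# - t) * y p + t * y q ⟩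

  OnSegment : Point → Point → Point → Set
  OnSegment p q r = ∃[ t ] UnitInterval t × r ≈ₚ interpolate p q t

  -- Cross product of q - o and r - o; it is negative exactly when the turn
  -- (by less than a straight angle) from q to r around o is clockwise.
  cross : Point → Point → Point → Carrier
  cross o q r = (x q - x o) * (y r - y o) - (y q - y o) * (x r - x o)

  module _ (G : Digraph) where

    open Digraph G

    Placement : Set
    Placement = Vertex → Point

    infix 4 _≐_
    _≐_ : Rel Placement 0ℓ
    Γ ≐ Δ = ∀ v → Γ v ≈ₚ Δ v

    IsDrawing : Placement → Set
    IsDrawing Γ = ∀ u v → Γ u ≈ₚ Γ v → u ≡ v

    Planar : Placement → Set
    Planar Γ = ∀ u v u′ v′ → Edge u v → Edge u′ v′ → ¬ (u ≡ u′ × v ≡ v′) →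
      ∀ p → OnSegment (Γ u) (Γ v) p → OnSegment (Γ u′) (Γ v′) p →
      ∃[ w ] (w ≡ u ⊎ w ≡ v) × (w ≡ u′ ⊎ w ≡ v′) × p ≈ₚ Γ w

    Upward : Placement → Set
    Upward Γ = ∀ u v → Edge u v →
      ∀ s t → UnitInterval s → UnitInterval t → s < t →
      y (interpolate (Γ u) (Γ v) s) < y (interpolate (Γ u) (Γ v) t)

    record IsUpwardPlanarDrawing (Γ : Placement) : Set where
      field
        isDrawing : IsDrawing Γ
        planar    : Planar Γ
        upward    : Upward Γ

    -- In an upward drawing the successors of v lie above v, so from left to
    -- right they are in clockwise order around v; the predecessors lie below v,
    -- so from left to right they are in counterclockwise order.
    IsSuccessorList IsPredecessorList : Placement → Vertex → List Vertex → Set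
    IsSuccessorList Γ v ws =
      (∀ w → w ∈ ws ⇔ Edge v w) ×
      AllPairs (λ u w → cross (Γ v) (Γ u) (Γ w) < 0#) ws
    IsPredecessorList Γ v us =
      (∀ u → u ∈ us ⇔ Edge u v) ×
      AllPairs (λ u w → 0# < cross (Γ v) (Γ u) (Γ w)) us

    record HasEmbedding (Γ : Placement) (𝒮 𝒫 : Vertex → List Vertex) : Set where
      field
        isUpwardPlanarDrawing : IsUpwardPlanarDrawing Γ
        successors            : ∀ v → IsSuccessorList Γ v (𝒮 v)
        predecessors          : ∀ v → IsPredecessorList Γ v (𝒫 v)

    OnDrawing : Placement → Point → Set
    OnDrawing Γ p =
      (∃[ v ] p ≈ₚ Γ v) ⊎
      (∃[ u ] ∃[ v ] Edge u v × OnSegment (Γ u) (Γ v) p)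

    FreeSegment : Placement → Rel Point 0ℓ
    FreeSegment Γ p q = ∀ r → OnSegment p q r → ¬ OnDrawing Γ r

    OutsideBox : Carrier → Point → Set
    OutsideBox b p = (b < x p ⊎ x p < - b) ⊎ (b < y p ⊎ y p < - b)

    -- The unbounded connected component of the complement of the drawing.
    -- Components of this open set are connected by polygonal paths.
    InOuterFace : Placement → Point → Set
    InOuterFace Γ p =
      ¬ OnDrawing Γ p × (∀ b → ∃[ q ] Star (FreeSegment Γ) p q × OutsideBox b q)

    OnOuterFace : Placement → Vertex → Set
    OnOuterFace Γ v = ∀ ε → 0# < ε → ∃[ p ] InOuterFace Γ p ×
      (- ε < x p - x (Γ v)) × (x p - x (Γ v) < ε) ×
      (- ε < y p - y (Γ v)) × (y p - y (Γ v) < ε)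

  -- A class of topologically equivalent drawings is determined by its lists
  -- of successors and predecessors; an embedding is such a family of lists
  -- that is realised by some upward planar drawing.
  record UpwardPlaneGraph : Set₁ where
    field
      graph     : Digraph
      connected : Digraph.Connected graph

    open Digraph graph public

    field
      𝒮 𝒫 : Vertex → List Vertex

    Respects : Placement graph → Set
    Respects Γ = HasEmbedding graph Γ 𝒮 𝒫

    UpwardPlanarDrawing : Set
    UpwardPlanarDrawing = ∃ Respects

    field
      realised : UpwardPlanarDrawing

  record PlaneSTGraph : Set₁ where
    field
      upwardPlaneGraph : UpwardPlaneGraph

    open UpwardPlaneGraph upwardPlaneGraph public

    field
      s t      : Vertex
      s-source : Source s
      t-sink   : Sink t
      s-unique : ∀ v → Source v → v ≡ s
      t-unique : ∀ v → Sink v → v ≡ t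
      -- Equivalent drawings have the same outer face.
      s-outer  : (Γ : UpwardPlanarDrawing) → OnOuterFace graph (proj₁ Γ) s
      t-outer  : (Γ : UpwardPlanarDrawing) → OnOuterFace graph (proj₁ Γ) t

  module _ (𝒢 : UpwardPlaneGraph) where

    open UpwardPlaneGraph 𝒢

    record Morph (k : ℕ) (Γ₀ Γ₁ : UpwardPlanarDrawing) : Set where
      field
        Λ     : Fin (suc k) → UpwardPlanarDrawing
        start : _≐_ graph (proj₁ (Λ Fin.zero)) (proj₁ Γ₀)
        end   : _≐_ graph (proj₁ (Λ (fromℕ k))) (proj₁ Γ₁)

      during : Fin k → Carrier → Placement graph
      during i t v =
        interpolate (proj₁ (Λ (inject₁ i)) v) (proj₁ (Λ (Fin.suc i)) v) t

      UpwardPlanar : Set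
      UpwardPlanar = ∀ i t → UnitInterval t → Respects (during i t)

{-# OPTIONS --safe #-}
-- The morph moves the vertices horizontally from Γ₀ to the abscissae K ^ rank v,
-- then vertically to their heights in Γ₁, and then horizontally to Γ₁.
--
-- A horizontal step between equivalent drawings is planar because the embedding
-- determines the order in which a horizontal line meets the edges: tracing two
-- edges downwards along incoming edges reduces their comparison to that of two
-- edges leaving a common vertex.
--
-- The rank is the left-to-right preorder of the spanning tree that consists of
-- the leftmost incoming edges.  In a reduced graph, if pq is an edge and
-- rank p < rank v < rank q, then p and v lie on a common directed path, so the
-- difference of their heights is bounded below.  Hence, if K is large compared
-- with the ratio of the vertical extents of the edges, the abscissae K ^ rank v
-- yield an upward planar drawing with the given embedding for all admissible
-- heights at once, in particular throughout the vertical step.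
module Submission where

open import Defs
import Algebra.Properties.Ring
import Algebra.Properties.Semiring.Exp
import Algebra.Properties.Semiring.Mult.TCOptimised
import Algebra.Solver.Ring
open import Algebra.Solver.Ring.AlmostCommutativeRing using (fromCommutativeRing; _-Raw-AlmostCommutative⟶_)
open import Data.Bool.Base using (if_then_else_)
open import Data.Empty using (⊥-elim)
open import Data.Fin.Base as Fin using (Fin)
import Data.Fin.Properties as Finₚ
import Data.Integer.Base as ℤ
open import Data.Integer.Base using (0ℤ; 1ℤ)
import Data.Integer.Properties as ℤₚ
open import Data.List.Base as List using (List; []; _∷_; length)
open import Data.List.Membership.Propositional using (_∈_)
open import Data.List.Relation.Unary.All as All using (All)
open import Data.List.Relation.Unary.AllPairs as AllPairs using (AllPairs; []; _∷_)
open import Data.List.Relation.Unary.Any using (here; there)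
open import Data.Maybe.Base using (Maybe; just; nothing; maybe′)
open import Data.Nat.Base as ℕ using (ℕ; zero; suc)
import Data.Nat.Properties as ℕₚ
open import Data.Product as Product using (Σ; ∃-syntax; _×_; _,_; proj₁; proj₂)
open import Data.Sum.Base as Sum using (_⊎_; inj₁; inj₂; [_,_]′)
open import Function.Base using (_∘_; id; case_of_)
open import Function.Bundles using (Equivalence)
open import Relation.Binary.Construct.Closure.ReflexiveTransitive using (Star; ε; _◅_; _◅◅_)
import Relation.Binary.Construct.StrictToNonStrict as StrictToNonStrict
open import Relation.Binary.Core using (Rel)
open import Relation.Binary.Definitions using (Tri; tri<; tri≈; tri>)
open import Relation.Binary.PropositionalEquality as ≡ using (_≡_; _≢_)
open import Relation.Binary.Structures using (IsStrictTotalOrder)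
open import Relation.Nullary using (¬_; Dec; yes; no; does)
open import Relation.Nullary.Decidable using (_×-dec_)

-- The heights in Γ₁ may order incomparable vertices quite differently from those in Γ₀, so the
-- vertical step can rely only on what directed paths force. Let `z` be the heavier end of an arc
-- between `p` and `z`, and let δ bound the vertical extents of all edges from below. At vertical
-- distance δ from `p` this arc has already left the strip that contains all arcs with lighter ends.
-- It can thus meet a lighter arc `(u , w)` only near the height of `p`, and `(u , w)` stays away
-- from there if a directed path leads from `p` to `u` or from `w` to `p`. The rank has to guarantee
-- this; a transitive edge `uw` with `p` on the path from `u` to `w` would spoil it. The ranks are
-- computed from Γ₀, but the facts about them that the vertical step uses speak only of edges, paths
-- and the lists `𝒮` and `𝒫`, so they apply to the heights in Γ₁ as well.

-- Arithmetic and inequalities in the ordered field.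

module OrderedField (ℝ : RealNumbers) where

  open RealNumbers ℝ
  open IsStrictTotalOrder isStrictTotalOrder public
    using (compare; _<?_; <-resp-≈) renaming (trans to <-trans; irrefl to <-irrefl)
  open Algebra.Properties.Ring ring using (-‿distribˡ-*; -‿distribʳ-*; -‿involutive; -‿+-comm; -0#≈0#)
  open Algebra.Properties.Semiring.Mult.TCOptimised semiring using (×-homo-+; ×1-homo-*) renaming (_×_ to _×ₙ_)
  open import Relation.Binary.Reasoning.Setoid setoid

  private
    fromℤ : ℤ.ℤ → Carrier
    fromℤ (ℤ.+ n)      = n ×ₙ 1#
    fromℤ (ℤ.-[1+ n ]) = - (suc n ×ₙ 1#)

    fromℤ-neg : ∀ i → fromℤ (ℤ.- i) ≈ - fromℤ i
    fromℤ-neg (ℤ.+ zero)   = sym -0#≈0#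
    fromℤ-neg (ℤ.+ suc n)  = refl
    fromℤ-neg (ℤ.-[1+ n ]) = sym (-‿involutive _)

    suc-× : ∀ n → suc n ×ₙ 1# ≈ 1# + n ×ₙ 1#
    suc-× = ×-homo-+ 1# 1

    fromℤ-⊖ : ∀ m n → fromℤ (m ℤ.⊖ n) ≈ m ×ₙ 1# - n ×ₙ 1#
    fromℤ-⊖ m       zero    = sym (trans (+-congˡ -0#≈0#) (+-identityʳ _))
    fromℤ-⊖ zero    (suc n) = sym (+-identityˡ _)
    fromℤ-⊖ (suc m) (suc n) = begin
      fromℤ (suc m ℤ.⊖ suc n)                    ≡⟨ ≡.cong fromℤ (ℤₚ.[1+m]⊖[1+n]≡m⊖n m n) ⟩
      fromℤ (m ℤ.⊖ n)                            ≈⟨ fromℤ-⊖ m n ⟩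
      m ×ₙ 1# - n ×ₙ 1#                          ≈⟨ +-congʳ (+-identityˡ _) ⟨
      (0# + m ×ₙ 1#) - n ×ₙ 1#                   ≈⟨ +-congʳ (+-congʳ (-‿inverseʳ 1#)) ⟨
      ((1# - 1#) + m ×ₙ 1#) - n ×ₙ 1#            ≈⟨ +-congʳ (trans (+-assoc _ _ _) (trans (+-congˡ (+-comm _ _)) (sym (+-assoc _ _ _)))) ⟩
      ((1# + m ×ₙ 1#) - 1#) - n ×ₙ 1#            ≈⟨ +-assoc _ _ _ ⟩
      (1# + m ×ₙ 1#) + (- 1# - n ×ₙ 1#)          ≈⟨ +-cong (sym (suc-× m)) (trans (-‿+-comm _ _) (-‿cong (sym (suc-× n)))) ⟩
      suc m ×ₙ 1# - suc n ×ₙ 1#                  ∎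

    fromℤ-+ : ∀ i j → fromℤ (i ℤ.+ j) ≈ fromℤ i + fromℤ j
    fromℤ-+ (ℤ.+ m)      (ℤ.+ n)      = ×-homo-+ 1# m n
    fromℤ-+ (ℤ.+ m)      (ℤ.-[1+ n ]) = fromℤ-⊖ m (suc n)
    fromℤ-+ (ℤ.-[1+ m ]) (ℤ.+ n)      = trans (fromℤ-⊖ n (suc m)) (+-comm _ _)
    fromℤ-+ (ℤ.-[1+ m ]) (ℤ.-[1+ n ]) = begin
      - (suc (suc (m ℕ.+ n)) ×ₙ 1#)              ≈⟨ -‿cong (trans (suc-× (suc (m ℕ.+ n))) (trans (+-congˡ (×-homo-+ 1# (suc m) n)) (trans (+-comm _ _) (trans (+-assoc _ _ _) (+-congˡ (trans (+-comm _ _) (sym (suc-× n)))))))) ⟩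
      - (suc m ×ₙ 1# + suc n ×ₙ 1#)              ≈⟨ -‿+-comm _ _ ⟨
      - (suc m ×ₙ 1#) - suc n ×ₙ 1#              ∎

    fromℤ-*-neg : ∀ i j → fromℤ (i ℤ.* j) ≈ fromℤ i * fromℤ j → fromℤ (ℤ.- i ℤ.* j) ≈ fromℤ (ℤ.- i) * fromℤ j
    fromℤ-*-neg i j eq = begin
      fromℤ (ℤ.- i ℤ.* j)       ≡⟨ ≡.cong fromℤ (ℤₚ.neg-distribˡ-* i j) ⟨
      fromℤ (ℤ.- (i ℤ.* j))     ≈⟨ fromℤ-neg (i ℤ.* j) ⟩
      - fromℤ (i ℤ.* j)         ≈⟨ -‿cong eq ⟩
      - (fromℤ i * fromℤ j)     ≈⟨ -‿distribˡ-* _ _ ⟩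
      - fromℤ i * fromℤ j       ≈⟨ *-congʳ (fromℤ-neg i) ⟨
      fromℤ (ℤ.- i) * fromℤ j   ∎

    fromℤ-*-nonneg : ∀ m j → fromℤ (ℤ.+ m ℤ.* j) ≈ fromℤ (ℤ.+ m) * fromℤ j
    fromℤ-*-nonneg m (ℤ.+ n)      = trans (reflexive (≡.cong fromℤ (≡.sym (ℤₚ.pos-* m n)))) (×1-homo-* m n)
    fromℤ-*-nonneg m (ℤ.-[1+ n ]) = begin
      fromℤ (ℤ.+ m ℤ.* (ℤ.- (ℤ.+ suc n)))   ≡⟨ ≡.cong fromℤ (ℤₚ.neg-distribʳ-* (ℤ.+ m) (ℤ.+ suc n)) ⟨
      fromℤ (ℤ.- (ℤ.+ m ℤ.* ℤ.+ suc n))     ≈⟨ fromℤ-neg (ℤ.+ m ℤ.* ℤ.+ suc n) ⟩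
      - fromℤ (ℤ.+ m ℤ.* ℤ.+ suc n)         ≈⟨ -‿cong (fromℤ-*-nonneg m (ℤ.+ suc n)) ⟩
      - (m ×ₙ 1# * (suc n ×ₙ 1#))           ≈⟨ -‿distribʳ-* _ _ ⟩
      m ×ₙ 1# * - (suc n ×ₙ 1#)             ∎

    fromℤ-* : ∀ i j → fromℤ (i ℤ.* j) ≈ fromℤ i * fromℤ j
    fromℤ-* (ℤ.+ m)      j = fromℤ-*-nonneg m j
    fromℤ-* (ℤ.-[1+ m ]) j = fromℤ-*-neg (ℤ.+ suc m) j (fromℤ-*-nonneg (suc m) j)

    -- Elements of an abstract field do not compute; integer coefficients let the solver cancel by
    -- computation.
    ℤ-morphism : ℤ.+-*-rawRing -Raw-AlmostCommutative⟶ fromCommutativeRing commutativeRing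
    ℤ-morphism = record
      { ⟦_⟧    = fromℤ
      ; +-homo = fromℤ-+
      ; *-homo = fromℤ-*
      ; -‿homo = fromℤ-neg
      ; 0-homo = refl
      ; 1-homo = refl
      }

    coeff≟ : ∀ i j → Maybe (fromℤ i ≈ fromℤ j)
    coeff≟ i j with i ℤₚ.≟ j
    ... | yes i≡j = just (reflexive (≡.cong fromℤ i≡j))
    ... | no  _   = nothing

  open Algebra.Solver.Ring ℤ.+-*-rawRing (fromCommutativeRing commutativeRing) ℤ-morphism coeff≟ public
    using (solve; _:+_; _:*_; _:-_; :-_; _:=_; con)

  private
    module N = StrictToNonStrict _≈_ _<_

  abstract
    <-respʳ : ∀ {a b c} → b ≈ c → a < b → a < c
    <-respʳ = proj₁ <-resp-≈

    <-respˡ : ∀ {a b c} → a ≈ b → a < c → b < c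
    <-respˡ = proj₂ <-resp-≈

    ≤-refl : ∀ {a} → a ≤ a
    ≤-refl = inj₂ refl

    ≤-trans : ∀ {a b c} → a ≤ b → b ≤ c → a ≤ c
    ≤-trans = N.trans isEquivalence <-resp-≈ <-trans

    <-≤-trans : ∀ {a b c} → a < b → b ≤ c → a < c
    <-≤-trans = N.<-≤-trans <-trans <-respʳ

    ≤-<-trans : ∀ {a b c} → a ≤ b → b < c → a < c
    ≤-<-trans = N.≤-<-trans sym <-trans <-respˡ

    ≤-total : ∀ a b → a ≤ b ⊎ b ≤ a
    ≤-total = N.total compare

    ≤-antisym : ∀ {a b} → a ≤ b → b ≤ a → a ≈ b
    ≤-antisym = N.antisym isEquivalence <-trans <-irrefl

    <⇒≱ : ∀ {a b} → a < b → ¬ b ≤ a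
    <⇒≱ a<b b≤a = <-irrefl refl (<-≤-trans a<b b≤a)

    ≮⇒≥ : ∀ {a b} → ¬ a < b → b ≤ a
    ≮⇒≥ {a} {b} a≮b with compare a b
    ... | tri< a<b _ _ = ⊥-elim (a≮b a<b)
    ... | tri≈ _ a≈b _ = inj₂ (sym a≈b)
    ... | tri> _ _ b<a = inj₁ b<a

    ≤-<-connex : ∀ a b → a ≤ b ⊎ b < a
    ≤-<-connex a b with compare a b
    ... | tri< a<b _ _ = inj₁ (inj₁ a<b)
    ... | tri≈ _ a≈b _ = inj₁ (inj₂ a≈b)
    ... | tri> _ _ b<a = inj₂ b<a

    0<-sub : ∀ {a b} → a < b → 0# < b - a
    0<-sub {a} {b} a<b = <-respˡ (-‿inverseʳ a) (+-mono-< a b (- a) a<b)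

    0≤-sub : ∀ {a b} → a ≤ b → 0# ≤ b - a
    0≤-sub (inj₁ a<b) = inj₁ (0<-sub a<b)
    0≤-sub {a} (inj₂ a≈b) = inj₂ (sym (trans (+-congʳ (sym a≈b)) (-‿inverseʳ a)))

    -- Inequalities below are proved by exhibiting the difference of the two
    -- sides as a manifestly positive expression d.
    <-by : ∀ {a b} d → 0# < d → b - a ≈ d → a < b
    <-by {a} {b} d 0<d eq =
      <-respˡ (+-identityˡ a)
        (<-respʳ (trans (+-congʳ (sym eq)) (solve 2 (λ a b → (b :- a) :+ a := b) refl a b))
          (+-mono-< 0# d a 0<d))

    ≤-by : ∀ {a b} d → 0# ≤ d → b - a ≈ d → a ≤ b
    ≤-by d (inj₁ 0<d) eq = inj₁ (<-by d 0<d eq)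
    ≤-by {a} {b} d (inj₂ 0≈d) eq =
      inj₂ (sym (trans (solve 2 (λ a b → b := (b :- a) :+ a) refl a b) (trans (+-congʳ (trans eq (sym 0≈d))) (+-identityˡ a))))

    0<+ : ∀ {a b} → 0# < a → 0# < b → 0# < a + b
    0<+ {a} {b} 0<a 0<b = <-trans 0<a (<-by b 0<b (solve 2 (λ a b → (a :+ b) :- a := b) refl a b))

    0<+≤ : ∀ {a b} → 0# < a → 0# ≤ b → 0# < a + b
    0<+≤ 0<a (inj₁ 0<b) = 0<+ 0<a 0<b
    0<+≤ {a} 0<a (inj₂ 0≈b) = <-respʳ (trans (sym (+-identityʳ a)) (+-congˡ 0≈b)) 0<a

    0≤+ : ∀ {a b} → 0# ≤ a → 0# ≤ b → 0# ≤ a + b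
    0≤+ (inj₁ 0<a) 0≤b = inj₁ (0<+≤ 0<a 0≤b)
    0≤+ {a} {b} (inj₂ 0≈a) 0≤b = ≤-trans 0≤b (inj₂ (trans (sym (+-identityˡ b)) (+-congʳ 0≈a)))

    0<* : ∀ {a b} → 0# < a → 0# < b → 0# < a * b
    0<* = *-pos _ _

    0≤* : ∀ {a b} → 0# ≤ a → 0# ≤ b → 0# ≤ a * b
    0≤* (inj₁ 0<a) (inj₁ 0<b) = inj₁ (0<* 0<a 0<b)
    0≤* {a} (inj₁ 0<a) (inj₂ 0≈b) = inj₂ (sym (trans (*-congˡ (sym 0≈b)) (zeroʳ a)))
    0≤* {b = b} (inj₂ 0≈a) _ = inj₂ (sym (trans (*-congʳ (sym 0≈a)) (zeroˡ b)))

    0≤1 : 0# ≤ 1#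
    0≤1 = inj₁ 0<1

    *-cancel-0< : ∀ {c a} → 0# < c → 0# < c * a → 0# < a
    *-cancel-0< {c} {a} 0<c 0<ca with compare 0# a
    ... | tri< 0<a _ _ = 0<a
    ... | tri≈ _ 0≈a _ = ⊥-elim (<-irrefl (sym (trans (*-congˡ (sym 0≈a)) (zeroʳ c))) 0<ca)
    ... | tri> _ _ a<0 = ⊥-elim (<-irrefl refl
      (<-respʳ (solve 2 (λ c a → c :* a :+ c :* (con 0ℤ :- a) := con 0ℤ) refl c a)
        (0<+ 0<ca (0<* 0<c (0<-sub a<0)))))

    inv : ∀ {a} → 0# < a → ∃[ b ] 0# < b × a * b ≈ 1#
    inv {a} 0<a with inverse a (λ a≈0 → <-irrefl (sym a≈0) 0<a)
    ... | b , ab≈1 = b , *-cancel-0< 0<a (<-respʳ (sym ab≈1) 0<1) , ab≈1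

    finite-bound : ∀ {n} (f : Fin n → Carrier) → ∃[ M ] 0# < M × (∀ i → f i ≤ M)
    finite-bound {zero} f = 1# , 0<1 , λ ()
    finite-bound {suc n} f with finite-bound (f ∘ Fin.suc)
    ... | M , 0<M , f≤M with ≤-total (f Fin.zero) M
    ...   | inj₁ f0≤M = M , 0<M , λ { Fin.zero → f0≤M ; (Fin.suc i) → f≤M i }
    ...   | inj₂ M≤f0 = f Fin.zero , <-≤-trans 0<M M≤f0 , λ { Fin.zero → ≤-refl ; (Fin.suc i) → ≤-trans (f≤M i) M≤f0 }

-- Positions in lists.

position : ∀ {n} → Fin n → List (Fin n) → ℕ
position a []       = 0
position a (b ∷ bs) = if does (a Finₚ.≟ b) then 0 else suc (position a bs)

position≤length : ∀ {n} (a : Fin n) bs → position a bs ℕ.≤ length bs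
position≤length a []       = ℕ.z≤n
position≤length a (b ∷ bs) with a Finₚ.≟ b
... | yes _ = ℕ.z≤n
... | no  _ = ℕ.s≤s (position≤length a bs)

position-injective : ∀ {n} {a b : Fin n} {cs} → a ∈ cs → b ∈ cs → position a cs ≡ position b cs → a ≡ b
position-injective {a = a} {b} {c ∷ cs} a∈ b∈ eq with a Finₚ.≟ c | b Finₚ.≟ c
... | yes a≡c | yes b≡c = ≡.trans a≡c (≡.sym b≡c)
position-injective (here a≡c)  _           eq | no a≢c | no _   = ⊥-elim (a≢c a≡c)
position-injective (there _)   (here b≡c)  eq | no _   | no b≢c = ⊥-elim (b≢c b≡c)
position-injective (there a∈) (there b∈) eq | no _   | no _   = position-injective a∈ b∈ (ℕₚ.suc-injective eq)

-- Turns the order of a list into a comparison of natural numbers, for which trichotomy is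
-- available. An absent element has the length of the list as its position, hence the membership
-- hypotheses.
allPairs-position : ∀ {n ℓ} {R : Rel (Fin n) ℓ} {a b : Fin n} {cs} → AllPairs R cs → a ∈ cs → b ∈ cs →
                    position a cs ℕ.< position b cs → R a b
allPairs-position {a = a} {b} {c ∷ cs} (Rc ∷ Rcs) a∈ b∈ lt with a Finₚ.≟ c | b Finₚ.≟ c
allPairs-position (Rc ∷ Rcs) a∈ (here b≡c) lt | yes ≡.refl | no b≢c = ⊥-elim (b≢c b≡c)
allPairs-position (Rc ∷ Rcs) a∈ (there b∈) lt | yes ≡.refl | no b≢c = All.lookup Rc b∈
allPairs-position (Rc ∷ Rcs) (here a≡c) b∈ lt | no a≢c | no _ = ⊥-elim (a≢c a≡c)
allPairs-position (Rc ∷ Rcs) (there a∈) (here b≡c) lt | no _ | no b≢c = ⊥-elim (b≢c b≡c)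
allPairs-position (Rc ∷ Rcs) (there a∈) (there b∈) (ℕ.s≤s lt) | no _ | no _ = allPairs-position Rcs a∈ b∈ lt

allPairs-mapWith∈ : ∀ {n ℓ ℓ′} {R : Rel (Fin n) ℓ} {S : Rel (Fin n) ℓ′} {cs : List (Fin n)} →
                    (∀ {a b} → a ∈ cs → b ∈ cs → R a b → S a b) → AllPairs R cs → AllPairs S cs
allPairs-mapWith∈ f [] = []
allPairs-mapWith∈ f (Rc ∷ Rcs) =
  All.tabulate (λ b∈ → f (here ≡.refl) (there b∈) (All.lookup Rc b∈)) ∷
  allPairs-mapWith∈ (λ a∈ b∈ → f (there a∈) (there b∈)) Rcs

-- Natural numbers in place of real heights.

module Below (ℝ : RealNumbers) where

  open RealNumbers ℝ
  open OrderedField ℝ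

  -- Makes induction along real heights an induction on natural numbers; the bound `n` allows it
  -- from above too.
  below : ∀ {n} → (Fin n → Carrier) → Carrier → ℕ
  below {zero}  f a = 0
  below {suc n} f a = (if does (f Fin.zero <? a) then 1 else 0) ℕ.+ below (f ∘ Fin.suc) a

  below≤ : ∀ {n} (f : Fin n → Carrier) a → below f a ℕ.≤ n
  below≤ {zero}  f a = ℕ.z≤n
  below≤ {suc n} f a with f Fin.zero <? a
  ... | yes _ = ℕ.s≤s (below≤ (f ∘ Fin.suc) a)
  ... | no  _ = ℕₚ.m≤n⇒m≤1+n (below≤ (f ∘ Fin.suc) a)

  below-mono : ∀ {n} (f : Fin n → Carrier) {a b} → a ≤ b → below f a ℕ.≤ below f b
  below-mono {zero}  f a≤b = ℕ.z≤n
  below-mono {suc n} f {a} {b} a≤b with f Fin.zero <? a | f Fin.zero <? b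
  ... | yes _   | yes _   = ℕ.s≤s (below-mono (f ∘ Fin.suc) a≤b)
  ... | yes f<a | no  f≮b = ⊥-elim (f≮b (<-≤-trans f<a a≤b))
  ... | no  _   | yes _   = ℕₚ.m≤n⇒m≤1+n (below-mono (f ∘ Fin.suc) a≤b)
  ... | no  _   | no  _   = below-mono (f ∘ Fin.suc) a≤b

  below-strict : ∀ {n} (f : Fin n → Carrier) i {b} → f i < b → below f (f i) ℕ.< below f b
  below-strict f i = strict f i refl
    where
    strict : ∀ {n} (f : Fin n → Carrier) i {a b} → f i ≈ a → a < b → below f a ℕ.< below f b
    strict f Fin.zero {a} {b} f0≈a a<b with f Fin.zero <? a | f Fin.zero <? b
    ... | yes f<a | _       = ⊥-elim (<-irrefl f0≈a f<a)
    ... | no  _   | yes _   = ℕ.s≤s (below-mono (f ∘ Fin.suc) (inj₁ a<b))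
    ... | no  _   | no  f≮b = ⊥-elim (f≮b (<-respˡ (sym f0≈a) a<b))
    strict f (Fin.suc i) {a} {b} fi≈a a<b with f Fin.zero <? a | f Fin.zero <? b
    ... | yes _   | yes _   = ℕ.s≤s (strict (f ∘ Fin.suc) i fi≈a a<b)
    ... | yes f<a | no  f≮b = ⊥-elim (f≮b (<-trans f<a a<b))
    ... | no  _   | yes _   = ℕₚ.m≤n⇒m≤1+n (strict (f ∘ Fin.suc) i fi≈a a<b)
    ... | no  _   | no  _   = strict (f ∘ Fin.suc) i fi≈a a<b

-- Linear interpolation and segments.

module Segments (ℝ : RealNumbers) where

  open RealNumbers ℝ
  open Plane ℝ
  open OrderedField ℝ

  ≈ₚ-refl : ∀ {p} → p ≈ₚ p
  ≈ₚ-refl = refl , refl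

  complement : ∀ {t} → UnitInterval t → UnitInterval (1# - t)
  complement {t} (0≤t , t≤1) = 0≤-sub t≤1 , ≤-by t 0≤t (solve 1 (λ t → con 1ℤ :- (con 1ℤ :- t) := t) refl t)

  mix : Carrier → Carrier → Carrier → Carrier
  mix a b t = (1# - t) * a + t * b

  abstract
    mix-cong : ∀ {a a′ b b′} t → a ≈ a′ → b ≈ b′ → mix a b t ≈ mix a′ b′ t
    mix-cong t a≈ b≈ = +-cong (*-congˡ a≈) (*-congˡ b≈)

    mix-idem : ∀ a t → mix a a t ≈ a
    mix-idem = solve 2 (λ a t → (con 1ℤ :- t) :* a :+ t :* a := a) refl

    mix-0 : ∀ a b → mix a b 0# ≈ a
    mix-0 = solve 2 (λ a b → (con 1ℤ :- con 0ℤ) :* a :+ con 0ℤ :* b := a) refl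

    mix-1 : ∀ a b → mix a b 1# ≈ b
    mix-1 = solve 2 (λ a b → (con 1ℤ :- con 1ℤ) :* a :+ con 1ℤ :* b := b) refl

    mix-comm : ∀ a b t → mix a b t ≈ mix b a (1# - t)
    mix-comm = solve 3 (λ a b t → (con 1ℤ :- t) :* a :+ t :* b := (con 1ℤ :- (con 1ℤ :- t)) :* b :+ (con 1ℤ :- t) :* a) refl

    mix-≥ : ∀ {a b c t} → UnitInterval t → c ≤ a → c ≤ b → c ≤ mix a b t
    mix-≥ {a} {b} {c} {t} t∈ c≤a c≤b =
      ≤-by ((1# - t) * (a - c) + t * (b - c)) (0≤+ (0≤* (0≤-sub (proj₂ t∈)) (0≤-sub c≤a)) (0≤* (proj₁ t∈) (0≤-sub c≤b)))
        (solve 4 (λ a b c t → ((con 1ℤ :- t) :* a :+ t :* b) :- c := (con 1ℤ :- t) :* (a :- c) :+ t :* (b :- c)) refl a b c t)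

    mix-≤ : ∀ {a b c t} → UnitInterval t → a ≤ c → b ≤ c → mix a b t ≤ c
    mix-≤ {a} {b} {c} {t} t∈ a≤c b≤c =
      ≤-by ((1# - t) * (c - a) + t * (c - b)) (0≤+ (0≤* (0≤-sub (proj₂ t∈)) (0≤-sub a≤c)) (0≤* (proj₁ t∈) (0≤-sub b≤c)))
        (solve 4 (λ a b c t → c :- ((con 1ℤ :- t) :* a :+ t :* b) := (con 1ℤ :- t) :* (c :- a) :+ t :* (c :- b)) refl a b c t)

    mix-mono : ∀ {a b s t} → a < b → s < t → mix a b s < mix a b t
    mix-mono {a} {b} {s} {t} a<b s<t = <-by ((t - s) * (b - a)) (0<* (0<-sub s<t) (0<-sub a<b))
      (solve 4 (λ a b s t → ((con 1ℤ :- t) :* a :+ t :* b) :- ((con 1ℤ :- s) :* a :+ s :* b) := (t :- s) :* (b :- a)) refl a b s t)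

    mix-injective : ∀ {a b s t} → a < b → mix a b s ≈ mix a b t → s ≈ t
    mix-injective {a} {b} {s} {t} a<b eq with compare s t
    ... | tri< s<t _ _ = ⊥-elim (<-irrefl eq (mix-mono a<b s<t))
    ... | tri≈ _ s≈t _ = s≈t
    ... | tri> _ _ t<s = ⊥-elim (<-irrefl (sym eq) (mix-mono a<b t<s))

    onSegment-resp : ∀ {a b a′ b′ p p′} → a ≈ₚ a′ → b ≈ₚ b′ → p ≈ₚ p′ → OnSegment a b p → OnSegment a′ b′ p′
    onSegment-resp (ax , ay) (bx , by) (px , py) (t , t∈ , ex , ey) =
      t , t∈ , trans (sym px) (trans ex (mix-cong t ax bx)) , trans (sym py) (trans ey (mix-cong t ay by))

    onSegment-start : ∀ a b → OnSegment a b a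
    onSegment-start a b = 0# , (≤-refl , 0≤1) , sym (mix-0 _ _) , sym (mix-0 _ _)

    onSegment-end : ∀ a b → OnSegment a b b
    onSegment-end a b = 1# , (0≤1 , ≤-refl) , sym (mix-1 _ _) , sym (mix-1 _ _)

    onSegment-flip : ∀ {a b p} → OnSegment a b p → OnSegment b a p
    onSegment-flip (t , t∈ , ex , ey) = 1# - t , complement t∈ , trans ex (mix-comm _ _ t) , trans ey (mix-comm _ _ t)

    onSegment-convex : ∀ {a b p q t} → UnitInterval t → OnSegment a b p → OnSegment a b q → OnSegment a b (interpolate p q t)
    onSegment-convex {t = t} t∈ (s₀ , s₀∈ , ex₀ , ey₀) (s₁ , s₁∈ , ex₁ , ey₁) =
      mix s₀ s₁ t , (mix-≥ t∈ (proj₁ s₀∈) (proj₁ s₁∈) , mix-≤ t∈ (proj₂ s₀∈) (proj₂ s₁∈)) ,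
      trans (mix-cong t ex₀ ex₁) (assoc _ _ s₀ s₁ t) , trans (mix-cong t ey₀ ey₁) (assoc _ _ s₀ s₁ t)
      where
      assoc : ∀ a b s₀ s₁ t → mix (mix a b s₀) (mix a b s₁) t ≈ mix a b (mix s₀ s₁ t)
      assoc = solve 5 (λ a b s₀ s₁ t →
        (con 1ℤ :- t) :* ((con 1ℤ :- s₀) :* a :+ s₀ :* b) :+ t :* ((con 1ℤ :- s₁) :* a :+ s₁ :* b) :=
        (con 1ℤ :- ((con 1ℤ :- t) :* s₀ :+ t :* s₁)) :* a :+ ((con 1ℤ :- t) :* s₀ :+ t :* s₁) :* b) refl

    onSegment-y≥ : ∀ {a b p} → y a ≤ y b → OnSegment a b p → y a ≤ y p
    onSegment-y≥ a≤b (t , t∈ , _ , ey) = ≤-trans (mix-≥ t∈ ≤-refl a≤b) (inj₂ (sym ey))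

    onSegment-y≤ : ∀ {a b p} → y a ≤ y b → OnSegment a b p → y p ≤ y b
    onSegment-y≤ a≤b (t , t∈ , _ , ey) = ≤-trans (inj₂ ey) (mix-≤ t∈ a≤b ≤-refl)

    onSegment-unique : ∀ {a b p q} → y a < y b → OnSegment a b p → OnSegment a b q → y p ≈ y q → x p ≈ x q
    onSegment-unique a<b (s , s∈ , ex , ey) (t , t∈ , ex′ , ey′) eq =
      trans ex (trans (+-cong (*-congʳ (+-congˡ (-‿cong s≈t))) (*-congʳ s≈t)) (sym ex′))
      where
      s≈t : s ≈ t
      s≈t = mix-injective a<b (trans (sym ey) (trans eq ey′))

    onSegment-at : ∀ {a b h} → y a < y b → y a ≤ h → h ≤ y b → ∃[ p ] OnSegment a b p × y p ≈ h
    onSegment-at {a} {b} {h} a<b a≤h h≤b with inv (0<-sub a<b)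
    ... | i , 0<i , eq = interpolate a b t ,
      (t , (0≤* (0≤-sub a≤h) (inj₁ 0<i) , t≤1) , ≈ₚ-refl) , mid
      where
      t : Carrier
      t = (h - y a) * i
      t≤1 : t ≤ 1#
      t≤1 = ≤-by ((y b - h) * i) (0≤* (0≤-sub h≤b) (inj₁ 0<i))
        (trans (+-congʳ (sym eq)) (solve 4 (λ a b h i → (b :- a) :* i :- (h :- a) :* i := (b :- h) :* i) refl (y a) (y b) h i))
      mid : mix (y a) (y b) t ≈ h
      mid = trans (solve 4 (λ a b h i → (con 1ℤ :- (h :- a) :* i) :* a :+ ((h :- a) :* i) :* b := a :+ (h :- a) :* ((b :- a) :* i)) refl (y a) (y b) h i)
        (trans (+-congˡ (trans (*-congˡ eq) (*-identityʳ _))) (solve 2 (λ a h → a :+ (h :- a) := h) refl (y a) h))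

    -- The difference of the two affine functions runs from `a - b` to `c - d`, so it vanishes at
    -- `t` = (b - a) / ((b - a) + (c - d)).
    crossing-time : ∀ {a b c d} → a < b → d < c →
                    ∃[ t ] 0# < t × t < 1# × mix a c t ≈ mix b d t
    crossing-time {a} {b} {c} {d} a<b d<c = weights (inv (0<+ (0<-sub a<b) (0<-sub d<c)))
      where
      weights : (∃[ i ] 0# < i × ((b - a) + (c - d)) * i ≈ 1#) → ∃[ t ] 0# < t × t < 1# × mix a c t ≈ mix b d t
      weights (i , 0<i , eq) = (b - a) * i , 0<* (0<-sub a<b) 0<i ,
        <-by ((c - d) * i) (0<* (0<-sub d<c) 0<i)
          (trans (+-congʳ (sym eq)) (solve 3 (λ p q i → (p :+ q) :* i :- p :* i := q :* i) refl (b - a) (c - d) i)) ,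
        trans (solve 5 (λ a b c d t → (con 1ℤ :- t) :* a :+ t :* c := ((con 1ℤ :- t) :* b :+ t :* d) :+ (((b :- a) :+ (c :- d)) :* t :- (b :- a))) refl a b c d ((b - a) * i))
          (trans (+-congˡ (trans (+-congʳ (solve 3 (λ p s i → s :* (p :* i) := p :* (s :* i)) refl (b - a) ((b - a) + (c - d)) i))
            (trans (+-congʳ (trans (*-congˡ eq) (*-identityʳ _))) (-‿inverseʳ (b - a))))) (+-identityʳ _))

    mix-between : ∀ {a b t} → 0# < t → t < 1# → a < b → a < mix a b t × mix a b t < b
    mix-between 0<t t<1 a<b = <-respˡ (mix-0 _ _) (mix-mono a<b 0<t) , <-respʳ (mix-1 _ _) (mix-mono a<b t<1)

    mix-between′ : ∀ {a b t} → 0# < t → t < 1# → b < a → b < mix a b t × mix a b t < a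
    mix-between′ {a} {b} {t} 0<t t<1 b<a =
      Product.map (<-respʳ (sym (mix-comm a b t))) (<-respˡ (sym (mix-comm a b t)))
        (mix-between (0<-sub t<1) (<-by t 0<t (solve 1 (λ t → con 1ℤ :- (con 1ℤ :- t) := t) refl t)) b<a)

    -- The left-to-right order changes between two heights, so the segments cross in between. The
    -- strict bounds keep the crossing away from the ends of the first segment, the only places
    -- where planarity would tolerate it.
    segments-meet : ∀ {a b c d p p′ q q′} → y a < y b → y c < y d →
                    OnSegment a b p → OnSegment a b p′ → OnSegment c d q → OnSegment c d q′ →
                    y p ≈ y q → y p′ ≈ y q′ → x p < x q → x q′ < x p′ →
                    ∃[ r ] OnSegment a b r × OnSegment c d r × y a < y r × y r < y b
    segments-meet {a} {b} {c} {d} {p} {p′} {q} {q′} a<b c<d p∈ p′∈ q∈ q′∈ yp≈yq yp′≈yq′ xp<xq xq′<xp′ =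
      meet (crossing-time xp<xq xq′<xp′)
      where
      meet : (∃[ t ] 0# < t × t < 1# × mix (x p) (x p′) t ≈ mix (x q) (x q′) t) →
             ∃[ r ] OnSegment a b r × OnSegment c d r × y a < y r × y r < y b
      meet (t , 0<t , t<1 , eq) = interpolate p p′ t , onSegment-convex t∈ p∈ p′∈ ,
        onSegment-resp ≈ₚ-refl ≈ₚ-refl (sym eq , sym (mix-cong t yp≈yq yp′≈yq′)) (onSegment-convex t∈ q∈ q′∈) ,
        inside (compare (y p) (y p′))
        where
        t∈ : UnitInterval t
        t∈ = (inj₁ 0<t , inj₁ t<1)
        a≤p : y a ≤ y p
        a≤p = onSegment-y≥ (inj₁ a<b) p∈
        p≤b : y p ≤ y b
        p≤b = onSegment-y≤ (inj₁ a<b) p∈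
        a≤p′ : y a ≤ y p′
        a≤p′ = onSegment-y≥ (inj₁ a<b) p′∈
        p′≤b : y p′ ≤ y b
        p′≤b = onSegment-y≤ (inj₁ a<b) p′∈
        inside : Tri (y p < y p′) (y p ≈ y p′) (y p′ < y p) → y a < mix (y p) (y p′) t × mix (y p) (y p′) t < y b
        inside (tri< p<p′ _ _) = Product.map (≤-<-trans a≤p) (λ u → <-≤-trans u p′≤b) (mix-between 0<t t<1 p<p′)
        inside (tri> _ _ p′<p) = Product.map (≤-<-trans a≤p′) (λ u → <-≤-trans u p≤b) (mix-between′ 0<t t<1 p′<p)
        -- At one height each segment has a single point, so the two opposite orders contradict each
        -- other.
        inside (tri≈ _ p≈p′ _) = ⊥-elim (<-irrefl refl (<-trans xp<xq (<-respˡ (sym xq≈xq′) (<-respʳ (sym xp≈xp′) xq′<xp′))))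
          where
          xp≈xp′ : x p ≈ x p′
          xp≈xp′ = onSegment-unique a<b p∈ p′∈ p≈p′
          xq≈xq′ : x q ≈ x q′
          xq≈xq′ = onSegment-unique c<d q∈ q′∈ (trans (sym yp≈yq) (trans p≈p′ yp′≈yq′))

    shares : ∀ {d₁ d₂ i} → 0# < d₁ → 0# < d₂ → 0# < i → (d₁ + d₂) * i ≈ 1# → UnitInterval (d₁ * i) × UnitInterval (d₂ * i)
    shares {d₁} {d₂} {i} 0<d₁ 0<d₂ 0<i eq =
      (inj₁ (0<* 0<d₁ 0<i) , ≤-by (d₂ * i) (inj₁ (0<* 0<d₂ 0<i)) (trans (+-congʳ (sym eq)) (solve 3 (λ d₁ d₂ i → (d₁ :+ d₂) :* i :- d₁ :* i := d₂ :* i) refl d₁ d₂ i))) ,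
      (inj₁ (0<* 0<d₂ 0<i) , ≤-by (d₁ * i) (inj₁ (0<* 0<d₁ 0<i)) (trans (+-congʳ (sym eq)) (solve 3 (λ d₁ d₂ i → (d₁ :+ d₂) :* i :- d₂ :* i := d₁ :* i) refl d₁ d₂ i)))

    mix-offset : ∀ o a t → mix o a t ≈ o + t * (a - o)
    mix-offset = solve 3 (λ o a t → (con 1ℤ :- t) :* o :+ t :* a := o :+ t :* (a :- o)) refl

    mix-difference : ∀ o a b s t → mix o b s - mix o a t ≈ s * (b - o) - t * (a - o)
    mix-difference o a b s t = trans (+-cong (mix-offset o b s) (-‿cong (mix-offset o a t)))
      (solve 3 (λ o p q → (o :+ p) :- (o :+ q) := p :- q) refl o _ _)

-- The left-to-right order of arcs in a drawing.

module Arcs (ℝ : RealNumbers) where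

  open RealNumbers ℝ
  open Plane ℝ
  open OrderedField ℝ
  open Segments ℝ

  module ArcOrder (𝒢 : UpwardPlaneGraph) (Γ : UpwardPlaneGraph.UpwardPlanarDrawing 𝒢) where

    open UpwardPlaneGraph 𝒢
    open HasEmbedding (proj₂ Γ)
    open IsUpwardPlanarDrawing isUpwardPlanarDrawing

    Arc : Set
    Arc = Vertex × Vertex

    IsArc : Arc → Set
    IsArc (u , v) = Edge u v

    P : Vertex → Point
    P = proj₁ Γ

    Y : Vertex → Carrier
    Y v = y (P v)

    On : Arc → Point → Set
    On (u , v) = OnSegment (P u) (P v)

    Endpoint : Vertex → Arc → Set
    Endpoint v e = v ≡ proj₁ e ⊎ v ≡ proj₂ e

    -- The height bounds are not strict: `v` may be level with an end of the arc, and is then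
    -- compared with that end.
    Spans : Arc → Vertex → Set
    Spans (u , w) v = (Y u ≤ Y v) × (Y v ≤ Y w) × v ≢ u × v ≢ w

    infix 4 _⋖_
    -- A single common height suffices as a witness, because by `⋖-asym` planarity makes the answer
    -- independent of the height.
    _⋖_ : Rel Arc _
    e ⋖ f = ∃[ p ] ∃[ q ] On e p × On f q × y p ≈ y q × x p < x q

    abstract
      rising : ∀ {u v} → Edge u v → Y u < Y v
      rising {u} {v} uv = <-respˡ (mix-0 _ _) (<-respʳ (mix-1 _ _) (upward u v uv 0# 1# (≤-refl , 0≤1) (0≤1 , ≤-refl) 0<1))

      on-endpoint : ∀ {v e} → Endpoint v e → On e (P v)
      on-endpoint (inj₁ ≡.refl) = onSegment-start _ _
      on-endpoint (inj₂ ≡.refl) = onSegment-end _ _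

      on-≥ : ∀ {u v p} → Edge u v → On (u , v) p → Y u ≤ y p
      on-≥ uv = onSegment-y≥ (inj₁ (rising uv))

      on-≤ : ∀ {u v p} → Edge u v → On (u , v) p → y p ≤ Y v
      on-≤ uv = onSegment-y≤ (inj₁ (rising uv))

      -- Opposite orders at two heights make the arcs meet strictly between the heights of the ends
      -- of `e`, hence not at a vertex that they share.
      ⋖-asym : ∀ {e f} → IsArc e → IsArc f → e ⋖ f → ¬ f ⋖ e
      ⋖-asym {u , w} {v , a} uw va (p , q , p∈e , q∈f , yp≈yq , xp<xq) (q′ , p′ , q′∈f , p′∈e , yq′≈yp′ , xq′<xp′)
        with (u Finₚ.≟ v) ×-dec (w Finₚ.≟ a)
      ... | yes (≡.refl , ≡.refl) = <-irrefl (onSegment-unique (rising uw) p∈e q∈f yp≈yq) xp<xq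
      ... | no e≢f with segments-meet (rising uw) (rising va) p∈e p′∈e q∈f q′∈f yp≈yq (sym yq′≈yp′) xp<xq xq′<xp′
      ...   | r , r∈e , r∈f , yu<yr , yr<yw with planar u w v a uw va e≢f r r∈e r∈f
      ...     | c , inj₁ ≡.refl , _ , _ , yr≈yc = <-irrefl (sym yr≈yc) yu<yr
      ...     | c , inj₂ ≡.refl , _ , _ , yr≈yc = <-irrefl yr≈yc yr<yw

      -- `Planar` speaks of pairs of edges; an arc `e` that ends in `v` is what keeps `v` off the
      -- arc `f`.
      beside : ∀ {v e f} → IsArc e → IsArc f → Endpoint v e → Spans f v →
               ∃[ q ] On f q × y q ≈ Y v × (x (P v) < x q ⊎ x q < x (P v))
      beside {v} {u , w} {a , b} uw ab v∈e (ya≤yv , yv≤yb , v≢a , v≢b) with onSegment-at (rising ab) ya≤yv yv≤yb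
      ... | q , q∈f , yq≈yv with compare (x (P v)) (x q)
      ...   | tri< xv<xq _ _ = q , q∈f , yq≈yv , inj₁ xv<xq
      ...   | tri> _ _ xq<xv = q , q∈f , yq≈yv , inj₂ xq<xv
      ...   | tri≈ _ xv≈xq _ with planar u w a b uw ab e≢f (P v) (on-endpoint v∈e) (onSegment-resp ≈ₚ-refl ≈ₚ-refl (sym xv≈xq , yq≈yv) q∈f)
        where
        e≢f : ¬ (u ≡ a × w ≡ b)
        e≢f (≡.refl , ≡.refl) = [ v≢a , v≢b ]′ v∈e
      ...     | c , _ , c∈f , v≈c = ⊥-elim ([ v≢a ∘ ≡.trans (isDrawing v c v≈c) , v≢b ∘ ≡.trans (isDrawing v c v≈c) ]′ c∈f)

      ⋖-connex : ∀ {v e f} → IsArc e → IsArc f → Endpoint v e → Spans f v → e ⋖ f ⊎ f ⋖ e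
      ⋖-connex ie if v∈e v∈f with beside ie if v∈e v∈f
      ... | q , q∈f , yq≈yv , inj₁ xv<xq = inj₁ (_ , q , on-endpoint v∈e , q∈f , sym yq≈yv , xv<xq)
      ... | q , q∈f , yq≈yv , inj₂ xq<xv = inj₂ (q , _ , q∈f , on-endpoint v∈e , yq≈yv , xq<xv)

      -- The basic step of tracing. The comparison may be read off at the height of `v`, where all
      -- arcs with the end `v` pass through the same point.
      ⋖-transferˡ : ∀ {v e f g} → IsArc e → IsArc f → Endpoint v e → Endpoint v g → Spans f v → e ⋖ f → g ⋖ f
      ⋖-transferˡ ie if v∈e v∈g v∈f e⋖f with beside ie if v∈e v∈f
      ... | q , q∈f , yq≈yv , inj₁ xv<xq = _ , q , on-endpoint v∈g , q∈f , sym yq≈yv , xv<xq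
      ... | q , q∈f , yq≈yv , inj₂ xq<xv = ⊥-elim (⋖-asym ie if e⋖f (q , _ , q∈f , on-endpoint v∈e , yq≈yv , xq<xv))

      ⋖-transferʳ : ∀ {v e f g} → IsArc e → IsArc f → Endpoint v e → Endpoint v g → Spans f v → f ⋖ e → f ⋖ g
      ⋖-transferʳ ie if v∈e v∈g v∈f f⋖e with beside ie if v∈e v∈f
      ... | q , q∈f , yq≈yv , inj₂ xq<xv = q , _ , q∈f , on-endpoint v∈g , yq≈yv , xq<xv
      ... | q , q∈f , yq≈yv , inj₁ xv<xq = ⊥-elim (⋖-asym ie if (_ , q , on-endpoint v∈e , q∈f , sym yq≈yv , xv<xq) f⋖e)

      ⋖-heightˡ : ∀ {u w v a} → Edge u w → Edge v a → (u , w) ⋖ (v , a) → Y u ≤ Y a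
      ⋖-heightˡ uw va (p , q , p∈e , q∈f , yp≈yq , _) = ≤-trans (on-≥ uw p∈e) (≤-trans (inj₂ yp≈yq) (on-≤ va q∈f))

      ⋖-heightʳ : ∀ {u w v a} → Edge u w → Edge v a → (u , w) ⋖ (v , a) → Y v ≤ Y w
      ⋖-heightʳ uw va (p , q , p∈e , q∈f , yp≈yq , _) = ≤-trans (on-≥ va q∈f) (≤-trans (inj₂ (sym yp≈yq)) (on-≤ uw p∈e))

      touching : ∀ {c e f p q} → IsArc e → IsArc f → Endpoint c e → Endpoint c f →
                 On e p → On f q → y p ≈ y q → y p ≈ Y c → ¬ x p < x q
      touching ie if c∈e c∈f p∈e q∈f yp≈yq yp≈yc = <-irrefl
        (trans (onSegment-unique (rising ie) p∈e (on-endpoint c∈e) yp≈yc)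
          (sym (onSegment-unique (rising if) q∈f (on-endpoint c∈f) (trans (sym yp≈yq) yp≈yc))))

      -- Arcs that meet head to tail share only the height of the common vertex, and there they
      -- coincide.
      ⋖⇒tail≢head : ∀ {u w v a} → Edge u w → Edge v a → (u , w) ⋖ (v , a) → u ≢ a
      ⋖⇒tail≢head uw va (p , q , p∈e , q∈f , yp≈yq , xp<xq) ≡.refl =
        touching uw va (inj₁ ≡.refl) (inj₂ ≡.refl) p∈e q∈f yp≈yq (≤-antisym (≤-trans (inj₂ yp≈yq) (on-≤ va q∈f)) (on-≥ uw p∈e)) xp<xq

      ⋖⇒head≢tail : ∀ {u w v a} → Edge u w → Edge v a → (u , w) ⋖ (v , a) → w ≢ v
      ⋖⇒head≢tail uw va (p , q , p∈e , q∈f , yp≈yq , xp<xq) ≡.refl =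
        touching uw va (inj₂ ≡.refl) (inj₁ ≡.refl) p∈e q∈f yp≈yq (≤-antisym (on-≤ uw p∈e) (≤-trans (on-≥ va q∈f) (inj₂ (sym yp≈yq)))) xp<xq

      -- The witnesses lie at the height y v + d₁ d₂ / (d₁ + d₂), where d₁ and d₂
      -- are the vertical extents of the two arcs.
      cross⇒⋖-out : ∀ {v a b} → Edge v a → Edge v b → cross (P v) (P a) (P b) < 0# → (v , a) ⋖ (v , b)
      cross⇒⋖-out {v} {a} {b} va vb cr<0 with inv (0<+ (0<-sub (rising va)) (0<-sub (rising vb)))
      ... | i , 0<i , eq with shares (0<-sub (rising va)) (0<-sub (rising vb)) 0<i eq
      ...   | t₁∈ , t₂∈ =
        interpolate (P v) (P a) (d₂ * i) , interpolate (P v) (P b) (d₁ * i) ,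
        (_ , t₂∈ , ≈ₚ-refl) , (_ , t₁∈ , ≈ₚ-refl) ,
        trans (mix-offset _ _ _) (trans (solve 4 (λ v d₁ d₂ i → v :+ (d₂ :* i) :* d₁ := v :+ (d₁ :* i) :* d₂) refl (Y v) d₁ d₂ i) (sym (mix-offset _ _ _))) ,
        <-by ((0# - cross (P v) (P a) (P b)) * i) (0<* (0<-sub cr<0) 0<i)
          (trans (mix-difference _ _ _ _ _)
            (solve 5 (λ d₁ d₂ a b i → (d₁ :* i) :* b :- (d₂ :* i) :* a := (con 0ℤ :- (a :* d₂ :- d₁ :* b)) :* i) refl d₁ d₂ _ _ i))
        where
        d₁ : Carrier
        d₁ = Y a - Y v
        d₂ : Carrier
        d₂ = Y b - Y v

      cross⇒⋖-in : ∀ {v a b} → Edge a v → Edge b v → 0# < cross (P v) (P a) (P b) → (a , v) ⋖ (b , v)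
      cross⇒⋖-in {v} {a} {b} av bv 0<cr with inv (0<+ (0<-sub (rising av)) (0<-sub (rising bv)))
      ... | i , 0<i , eq with shares (0<-sub (rising av)) (0<-sub (rising bv)) 0<i eq
      ...   | t₁∈ , t₂∈ =
        interpolate (P v) (P a) (d₂ * i) , interpolate (P v) (P b) (d₁ * i) ,
        onSegment-flip (_ , t₂∈ , ≈ₚ-refl) , onSegment-flip (_ , t₁∈ , ≈ₚ-refl) ,
        trans (mix-offset _ _ _) (trans (solve 4 (λ v a b i → v :+ ((v :- b) :* i) :* (a :- v) := v :+ ((v :- a) :* i) :* (b :- v)) refl (Y v) (Y a) (Y b) i) (sym (mix-offset _ _ _))) ,
        <-by (cross (P v) (P a) (P b) * i) (0<* 0<cr 0<i)
          (trans (mix-difference _ _ _ _ _)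
            (trans (+-cong (flip (Y v) (Y a)) (-‿cong (flip (Y v) (Y b))))
              (solve 5 (λ e₁ e₂ a b i → (:- (e₁ :* i) :* b) :- (:- (e₂ :* i) :* a) := (a :* e₂ :- e₁ :* b) :* i) refl (Y a - Y v) (Y b - Y v) _ _ i)))
        where
        d₁ : Carrier
        d₁ = Y v - Y a
        d₂ : Carrier
        d₂ = Y v - Y b
        flip : ∀ v a {c} → ((v - a) * i) * c ≈ - ((a - v) * i) * c
        flip v a = solve 4 (λ v a i c → ((v :- a) :* i) :* c := :- ((a :- v) :* i) :* c) refl v a i _

      𝒮-∈ : ∀ {v w} → Edge v w → w ∈ 𝒮 v
      𝒮-∈ {v} {w} = Equivalence.from (proj₁ (successors v) w)

      𝒫-∈ : ∀ {u v} → Edge u v → u ∈ 𝒫 v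
      𝒫-∈ {u} {v} = Equivalence.from (proj₁ (predecessors v) u)

      𝒮-edge : ∀ {v w} → w ∈ 𝒮 v → Edge v w
      𝒮-edge {v} {w} = Equivalence.to (proj₁ (successors v) w)

      𝒫-edge : ∀ {u v} → u ∈ 𝒫 v → Edge u v
      𝒫-edge {u} {v} = Equivalence.to (proj₁ (predecessors v) u)

      ⋖-out : ∀ {v a b} → Edge v a → Edge v b → position a (𝒮 v) ℕ.< position b (𝒮 v) → (v , a) ⋖ (v , b)
      ⋖-out {v} va vb lt = cross⇒⋖-out va vb (allPairs-position (proj₂ (successors v)) (𝒮-∈ va) (𝒮-∈ vb) lt)

      ⋖-in : ∀ {v a b} → Edge a v → Edge b v → position a (𝒫 v) ℕ.< position b (𝒫 v) → (a , v) ⋖ (b , v)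
      ⋖-in {v} av bv lt = cross⇒⋖-in av bv (allPairs-position (proj₂ (predecessors v)) (𝒫-∈ av) (𝒫-∈ bv) lt)

      ⋖-out⁻¹ : ∀ {v a b} → Edge v a → Edge v b → (v , a) ⋖ (v , b) → position a (𝒮 v) ℕ.< position b (𝒮 v)
      ⋖-out⁻¹ {v} va vb a⋖b with ℕₚ.<-cmp (position _ (𝒮 v)) (position _ (𝒮 v))
      ... | tri< lt _ _ = lt
      ... | tri> _ _ gt = ⊥-elim (⋖-asym va vb a⋖b (⋖-out vb va gt))
      ... | tri≈ _ eq _ with ≡.refl ← position-injective (𝒮-∈ va) (𝒮-∈ vb) eq = ⊥-elim (⋖-asym va va a⋖b a⋖b)

-- The tree of leftmost incoming edges and its preorder ranks.

finite-boundℕ : ∀ {n} (f : Fin n → ℕ) → ∃[ M ] (∀ i → f i ℕ.≤ M)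
finite-boundℕ {zero}  f = 0 , λ ()
finite-boundℕ {suc n} f with finite-boundℕ (f ∘ Fin.suc)
... | M , f≤M = f Fin.zero ℕ.+ M , λ { Fin.zero → ℕₚ.m≤m+n _ M ; (Fin.suc i) → ℕₚ.≤-trans (f≤M i) (ℕₚ.m≤n+m M _) }

module Trees (ℝ : RealNumbers) where

  open RealNumbers ℝ
  open Plane ℝ
  open OrderedField ℝ
  open Below ℝ
  open Arcs ℝ

  module STDrawing (𝒢 : PlaneSTGraph) (Γ : PlaneSTGraph.UpwardPlanarDrawing 𝒢) where

    open PlaneSTGraph 𝒢
    open ArcOrder upwardPlaneGraph Γ public

    level : Vertex → ℕ
    level v = below Y (Y v)

    level-< : ∀ {u v} → Y u < Y v → level u ℕ.< level v
    level-< {u} = below-strict Y u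

    level≤order : ∀ v → level v ℕ.≤ order
    level≤order v = below≤ Y (Y v)

    Parent : Vertex → Vertex → Set
    Parent p v = List.head (𝒫 v) ≡ just p

    abstract
      parent-edge : ∀ {p v} → Parent p v → Edge p v
      parent-edge {p} {v} pv = 𝒫-edge (head-∈ (𝒫 v) pv)
        where
        head-∈ : ∀ us → List.head us ≡ just p → p ∈ us
        head-∈ (u ∷ us) ≡.refl = here ≡.refl

      ∃parent : ∀ {v} → v ≢ s → ∃[ p ] Parent p v
      ∃parent {v} v≢s = find (𝒫 v) ≡.refl
        where
        find : ∀ us → 𝒫 v ≡ us → ∃[ p ] Parent p v
        find (u ∷ us) eq = u , ≡.cong List.head eq
        find []       eq = ⊥-elim (v≢s (s-unique v (λ u uv → case ≡.subst (u ∈_) eq (𝒫-∈ uv) of λ ())))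

      ∃successor : ∀ {v} → v ≢ t → ∃[ w ] Edge v w
      ∃successor {v} v≢t = find (𝒮 v) ≡.refl
        where
        find : ∀ ws → 𝒮 v ≡ ws → ∃[ w ] Edge v w
        find (w ∷ ws) eq = w , 𝒮-edge (≡.subst (w ∈_) (≡.sym eq) (here ≡.refl))
        find []       eq = ⊥-elim (v≢t (t-unique v (λ w vw → case ≡.subst (w ∈_) eq (𝒮-∈ vw) of λ ())))

      star-≤ : ∀ {u v} → Star Edge u v → Y u ≤ Y v
      star-≤ ε        = ≤-refl
      star-≤ (e ◅ es) = ≤-trans (inj₁ (rising e)) (star-≤ es)

      s-reaches : ∀ v → Star Edge s v
      s-reaches v = climb (suc (level v)) v ℕₚ.≤-refl
        where
        climb : ∀ k v → level v ℕ.< k → Star Edge s v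
        climb (suc k) v lt with v Finₚ.≟ s
        ... | yes ≡.refl = ε
        ... | no v≢s with ∃parent v≢s
        ...   | p , pv = climb k p (ℕₚ.<-≤-trans (level-< (rising (parent-edge pv))) (ℕ.s≤s⁻¹ lt)) ◅◅ (parent-edge pv ◅ ε)

      -- Induction from the top of the drawing: levels are at most `order`, so `order ∸ level v`
      -- decreases on the way up.
      height-induction : ∀ {ℓ} (Q : Vertex → Set ℓ) → (∀ v → (∀ {w} → Y v < Y w → Q w) → Q v) → ∀ v → Q v
      height-induction Q step v = go (suc (order ℕ.∸ level v)) v ℕₚ.≤-refl
        where
        go : ∀ k v → order ℕ.∸ level v ℕ.< k → Q v
        go (suc k) v lt = step v λ {w} v<w →
          go k w (ℕₚ.<-≤-trans (ℕₚ.∸-monoʳ-< (level-< v<w) (level≤order w)) (ℕ.s≤s⁻¹ lt))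

      reaches-t : ∀ v → Star Edge v t
      reaches-t = height-induction (λ v → Star Edge v t) climb
        where
        climb : ∀ v → (∀ {w} → Y v < Y w → Star Edge w t) → Star Edge v t
        climb v ih with v Finₚ.≟ t
        ... | yes ≡.refl = ε
        ... | no v≢t with ∃successor v≢t
        ...   | w , vw = vw ◅ ih (rising vw)

      s-lowest : ∀ {v} → v ≢ s → Y s < Y v
      s-lowest {v} v≢s with s-reaches v
      ... | ε      = ⊥-elim (v≢s ≡.refl)
      ... | e ◅ es = <-≤-trans (rising e) (star-≤ es)

      -- Ensures that the higher of two distinct vertices has a parent, so that tracing can continue
      -- downwards.
      ≥⇒≢s : ∀ {u v} → Y v ≤ Y u → u ≢ v → u ≢ s
      ≥⇒≢s v≤u u≢v ≡.refl = <⇒≱ (s-lowest (u≢v ∘ ≡.sym)) v≤u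

  module LeftTree (𝒢 : PlaneSTGraph) (Γ : PlaneSTGraph.UpwardPlanarDrawing 𝒢) (reduced : PlaneSTGraph.Reduced 𝒢) where

    open PlaneSTGraph 𝒢
    open STDrawing 𝒢 Γ public

    private
      maxDegree : ∃[ M ] (∀ v → length (𝒮 v) ℕ.≤ M)
      maxDegree = finite-boundℕ (length ∘ 𝒮)

      -- The first slot of a subtree belongs to its root. A child at position k starts `suc k` slots
      -- after the root and fills at most one slot, so k + 2 slots must fit, where k is at most the
      -- maximum degree.
      base : ℕ
      base = 2 ℕ.+ proj₁ maxDegree

    -- The exponent falls as the level rises: a child has a greater level than `v`, so its whole
    -- subtree needs at most one slot of `v`.
    width slot : Vertex → ℕ
    width v = base ℕ.^ (order ℕ.∸ level v)
    slot  v = base ℕ.^ (order ℕ.∸ suc (level v))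

    -- The preorder rank in the tree of leftmost incoming edges: the
    -- descendants of v have ranks in the interval [rank v , rank v + width v).
    rankUpTo : ℕ → Vertex → ℕ
    rankUpTo zero    v = 0
    rankUpTo (suc k) v = maybe′ (λ p → rankUpTo k p ℕ.+ suc (position v (𝒮 p)) ℕ.* slot p) 0 (List.head (𝒫 v))

    rank : Vertex → ℕ
    rank v = rankUpTo (suc (level v)) v

    abstract
      parent-level : ∀ {p v} → Parent p v → level p ℕ.< level v
      parent-level pv = level-< (rising (parent-edge pv))

      -- Parents have smaller levels, so fuel that exceeds the level of a vertex lasts down to the
      -- source, and any two such amounts give the same value.
      rank-parent : ∀ {p v} → Parent p v → rank v ≡ rank p ℕ.+ suc (position v (𝒮 p)) ℕ.* slot p
      rank-parent {p} {v} pv with List.head (𝒫 v) | pv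
      ... | just _ | ≡.refl = ≡.cong (ℕ._+ suc (position v (𝒮 p)) ℕ.* slot p) (fuel (level v) (suc (level p)) p (parent-level pv) ℕₚ.≤-refl)
        where
        fuel : ∀ k k′ v → level v ℕ.< k → level v ℕ.< k′ → rankUpTo k v ≡ rankUpTo k′ v
        fuel (suc k) (suc k′) v lt lt′ with List.head (𝒫 v) in eq
        ... | nothing = ≡.refl
        ... | just p  = ≡.cong (ℕ._+ suc (position v (𝒮 p)) ℕ.* slot p)
          (fuel k k′ p (ℕₚ.<-≤-trans (parent-level eq) (ℕ.s≤s⁻¹ lt)) (ℕₚ.<-≤-trans (parent-level eq) (ℕ.s≤s⁻¹ lt′)))

      width>0 : ∀ v → 0 ℕ.< width v
      width>0 v = ℕₚ.m^n>0 base (order ℕ.∸ level v)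

      slot>0 : ∀ v → 0 ℕ.< slot v
      slot>0 v = ℕₚ.m^n>0 base (order ℕ.∸ suc (level v))

      width≡base*slot : ∀ {v} → level v ℕ.< order → width v ≡ base ℕ.* slot v
      width≡base*slot {v} lt = ≡.cong (base ℕ.^_) (suc-∸-suc lt)
        where
        suc-∸-suc : ∀ {m n} → m ℕ.< n → n ℕ.∸ m ≡ suc (n ℕ.∸ suc m)
        suc-∸-suc {zero}  (ℕ.s≤s _) = ≡.refl
        suc-∸-suc {suc m} (ℕ.s≤s lt) = suc-∸-suc lt

      width≤slot : ∀ {p v} → Parent p v → width v ℕ.≤ slot p
      width≤slot pv = ℕₚ.^-monoʳ-≤ base (ℕₚ.∸-monoʳ-≤ order (parent-level pv))

      after-slot : ∀ {p v} → Parent p v → rank v ℕ.+ width v ℕ.≤ rank p ℕ.+ suc (suc (position v (𝒮 p))) ℕ.* slot p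
      after-slot {p} {v} pv = begin
        rank v ℕ.+ width v                                                ≡⟨ ≡.cong (ℕ._+ width v) (rank-parent pv) ⟩
        (rank p ℕ.+ suc (position v (𝒮 p)) ℕ.* slot p) ℕ.+ width v        ≤⟨ ℕₚ.+-monoʳ-≤ _ (width≤slot pv) ⟩
        (rank p ℕ.+ suc (position v (𝒮 p)) ℕ.* slot p) ℕ.+ slot p         ≡⟨ ℕₚ.+-assoc (rank p) _ _ ⟩
        rank p ℕ.+ (suc (position v (𝒮 p)) ℕ.* slot p ℕ.+ slot p)         ≡⟨ ≡.cong (rank p ℕ.+_) (ℕₚ.+-comm _ (slot p)) ⟩
        rank p ℕ.+ suc (suc (position v (𝒮 p))) ℕ.* slot p                ∎
        where open ℕₚ.≤-Reasoning

    infix 4 _⊏_ _◁_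
    infixl 5 _▹_

    -- Proper ancestors in the tree. The last parent edge is split off because parents are unique,
    -- while a vertex may have many children.
    data _⊏_ (a : Vertex) : Vertex → Set where
      [_] : ∀ {b} → Parent a b → a ⊏ b
      _▹_ : ∀ {p b} → a ⊏ p → Parent p b → a ⊏ b

    -- The subtree of a is to the left of the subtree of b.
    _◁_ : Rel Vertex _
    a ◁ b = rank a ℕ.+ width a ℕ.≤ rank b

    abstract
      parent-rank : ∀ {p v} → Parent p v → rank p ℕ.< rank v
      parent-rank {p} {v} pv = ≡.subst (rank p ℕ.<_) (≡.sym (rank-parent pv))
        (ℕₚ.m<m+n (rank p) (ℕₚ.<-≤-trans (slot>0 p) (ℕₚ.m≤m+n (slot p) _)))

      parent-nested : ∀ {p v} → Parent p v → rank v ℕ.+ width v ℕ.≤ rank p ℕ.+ width p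
      parent-nested {p} {v} pv = ℕₚ.≤-trans (after-slot pv) (ℕₚ.+-monoʳ-≤ (rank p)
        (≡.subst (suc (suc (position v (𝒮 p))) ℕ.* slot p ℕ.≤_) (≡.sym (width≡base*slot (ℕₚ.<-≤-trans (parent-level pv) (level≤order v))))
          (ℕₚ.*-monoˡ-≤ (slot p) (ℕ.s≤s (ℕ.s≤s (ℕₚ.≤-trans (position≤length v (𝒮 p)) (proj₂ maxDegree p)))))))

      siblings-◁ : ∀ {p a b} → Parent p a → Parent p b → position a (𝒮 p) ℕ.< position b (𝒮 p) → a ◁ b
      siblings-◁ {p} pa pb lt = ℕₚ.≤-trans (after-slot pa)
        (≡.subst (_ ℕ.≤_) (≡.sym (rank-parent pb)) (ℕₚ.+-monoʳ-≤ (rank p) (ℕₚ.*-monoˡ-≤ (slot p) (ℕ.s≤s lt))))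

      ⊏⇒rank< : ∀ {a b} → a ⊏ b → rank a ℕ.< rank b
      ⊏⇒rank< [ ab ]    = parent-rank ab
      ⊏⇒rank< (ap ▹ pb) = ℕₚ.<-trans (⊏⇒rank< ap) (parent-rank pb)

      ⊏-nested : ∀ {a b} → a ⊏ b → rank b ℕ.+ width b ℕ.≤ rank a ℕ.+ width a
      ⊏-nested [ ab ]    = parent-nested ab
      ⊏-nested (ap ▹ pb) = ℕₚ.≤-trans (parent-nested pb) (⊏-nested ap)

      ⊏⇒Y< : ∀ {a b} → a ⊏ b → Y a < Y b
      ⊏⇒Y< [ ab ]    = rising (parent-edge ab)
      ⊏⇒Y< (ap ▹ pb) = <-trans (⊏⇒Y< ap) (rising (parent-edge pb))

      ◁⇒rank< : ∀ {a b} → a ◁ b → rank a ℕ.< rank b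
      ◁⇒rank< {a} ab = ℕₚ.<-≤-trans (ℕₚ.m<m+n (rank a) (width>0 a)) ab

      ◁-asym : ∀ {a b} → a ◁ b → ¬ b ◁ a
      ◁-asym ab ba = ℕₚ.<-asym (◁⇒rank< ab) (◁⇒rank< ba)

      ◁-irrefl : ∀ {a} → ¬ a ◁ a
      ◁-irrefl aa = ◁-asym aa aa

      ◁-⊏ˡ : ∀ {a b c} → a ⊏ b → a ◁ c → b ◁ c
      ◁-⊏ˡ ab ac = ℕₚ.≤-trans (⊏-nested ab) ac

      ◁-⊏ʳ : ∀ {a b c} → a ⊏ b → c ◁ a → c ◁ b
      ◁-⊏ʳ ab ca = ℕₚ.≤-trans ca (ℕₚ.<⇒≤ (⊏⇒rank< ab))

      ◁⇒¬⊏ : ∀ {a b} → a ◁ b → ¬ a ⊏ b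
      ◁⇒¬⊏ a◁b a⊏b = ◁-irrefl (◁-⊏ˡ a⊏b a◁b)

      ◁⇒¬⊐ : ∀ {a b} → a ◁ b → ¬ b ⊏ a
      ◁⇒¬⊐ a◁b b⊏a = ℕₚ.<-asym (◁⇒rank< a◁b) (⊏⇒rank< b⊏a)

    Plus : Rel Vertex _
    Plus u w = ∃[ v ] Edge u v × Star Edge v w

    abstract
      plus⇒star : ∀ {u v} → Plus u v → Star Edge u v
      plus⇒star (_ , e , es) = e ◅ es

      star-plus : ∀ {u v w} → Star Edge u v → Plus v w → Plus u w
      star-plus ε        p = p
      star-plus (e ◅ es) p = _ , e , es ◅◅ plus⇒star p

      star⇒plus : ∀ {u v} → u ≢ v → Star Edge u v → Plus u v
      star⇒plus u≢v ε        = ⊥-elim (u≢v ≡.refl)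
      star⇒plus u≢v (e ◅ es) = _ , e , es

      ⊏⇒plus : ∀ {a b} → a ⊏ b → Plus a b
      ⊏⇒plus [ ab ]    = _ , parent-edge ab , ε
      ⊏⇒plus (ap ▹ pb) = star-plus (plus⇒star (⊏⇒plus ap)) (_ , parent-edge pb , ε)

      -- The one place where reducedness enters: a walk through `c` visits at least three vertices
      -- and so differs from the edge `uw`.
      no-detour : ∀ {u c w} → Edge u w → Plus u c → ¬ Plus c w
      no-detour {u} {c} {w} uw (a , ua , a⇝c) c⇝w with star-plus a⇝c c⇝w
      ... | b , ab , b⇝w with path b⇝w
        where
        path : ∀ {v} → Star Edge v w → ∃[ vs ] Path v w (v ∷ vs)
        path ε        = [] , [ w ]
        path (e ◅ es) = _ , e ∷ proj₂ (path es)
      ...   | vs , π = reduced u w (uw , u ∷ a ∷ b ∷ vs , ua ∷ ab ∷ π , λ ())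

-- The order of subtrees compared with the order of arcs.

module Ranks (ℝ : RealNumbers) where

  open RealNumbers ℝ
  open Plane ℝ
  open OrderedField ℝ
  open Trees ℝ

  module LeftTreeGeometry (𝒢 : PlaneSTGraph) (Γ : PlaneSTGraph.UpwardPlanarDrawing 𝒢) (reduced : PlaneSTGraph.Reduced 𝒢) where

    open PlaneSTGraph 𝒢
    open LeftTree 𝒢 Γ reduced public

    data Trichotomy (a b : Vertex) : Set where
      ancestor   : a ⊏ b → Trichotomy a b
      descendant : b ⊏ a → Trichotomy a b
      left       : a ◁ b → Trichotomy a b
      right      : b ◁ a → Trichotomy a b

    abstract
      -- Moves the comparison down to the higher of the two tails, which the other arc spans; `g` is
      -- to be the parent edge of `u`.
      lowerˡ : ∀ {u w v a g} → Edge u w → Edge v a → (u , w) ⋖ (v , a) → Y v ≤ Y u → u ≢ v → Endpoint u g → g ⋖ (v , a)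
      lowerˡ uw va e⋖f v≤u u≢v u∈g = ⋖-transferˡ uw va (inj₁ ≡.refl) u∈g (v≤u , ⋖-heightˡ uw va e⋖f , u≢v , ⋖⇒tail≢head uw va e⋖f) e⋖f

      lowerʳ : ∀ {u w v a g} → Edge u w → Edge v a → (u , w) ⋖ (v , a) → Y u ≤ Y v → u ≢ v → Endpoint v g → (u , w) ⋖ g
      lowerʳ uw va e⋖f u≤v u≢v v∈g = ⋖-transferʳ va uw (inj₁ ≡.refl) v∈g
        (u≤v , ⋖-heightʳ uw va e⋖f , u≢v ∘ ≡.sym , ⋖⇒head≢tail uw va e⋖f ∘ ≡.sym) e⋖f

      -- Replacing the arc with the higher tail by the parent edge of that tail keeps the order of
      -- the arcs and only enlarges the subtree. In the end both arcs leave the same vertex, where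
      -- `𝒮` orders the siblings.
      tree-⋖⇒◁ : ∀ {p a q b} → Parent p a → Parent q b → (p , a) ⋖ (q , b) → a ◁ b
      tree-⋖⇒◁ {p} {q = q} = go (suc (level p ℕ.+ level q)) ℕₚ.≤-refl
        where
        go : ∀ k {p a q b} → level p ℕ.+ level q ℕ.< k → Parent p a → Parent q b → (p , a) ⋖ (q , b) → a ◁ b
        go (suc k) {p} {a} {q} {b} lt pa qb a⋖b with p Finₚ.≟ q
        ... | yes ≡.refl = siblings-◁ pa qb (⋖-out⁻¹ (parent-edge pa) (parent-edge qb) a⋖b)
        ... | no p≢q with ≤-total (Y q) (Y p)
        ...   | inj₁ q≤p =
          let p′ , p′p = ∃parent (≥⇒≢s q≤p p≢q) in
          ◁-⊏ˡ [ pa ] (go k (ℕₚ.<-≤-trans (ℕₚ.+-monoˡ-< (level q) (parent-level p′p)) (ℕ.s≤s⁻¹ lt)) p′p qb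
            (lowerˡ (parent-edge pa) (parent-edge qb) a⋖b q≤p p≢q (inj₂ ≡.refl)))
        ...   | inj₂ p≤q =
          let q′ , q′q = ∃parent (≥⇒≢s p≤q (p≢q ∘ ≡.sym)) in
          ◁-⊏ʳ [ qb ] (go k (ℕₚ.<-≤-trans (ℕₚ.+-monoʳ-< (level p) (parent-level q′q)) (ℕ.s≤s⁻¹ lt)) pa q′q
            (lowerʳ (parent-edge pa) (parent-edge qb) a⋖b p≤q p≢q (inj₂ ≡.refl)))

      -- Only the tail `u` is located, as `uw` may lie outside the tree. Tracing the tree arc down
      -- either reaches `u` itself or ends below `u`; in the latter case the parent edge of `u`
      -- takes the place of `uw`.
      tree-⋖ : ∀ {p a u w} → Parent p a → Edge u w → (p , a) ⋖ (u , w) → a ◁ u ⊎ u ⊏ a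
      tree-⋖ {p} = go (suc (level p)) ℕₚ.≤-refl
        where
        go : ∀ k {p a u w} → level p ℕ.< k → Parent p a → Edge u w → (p , a) ⋖ (u , w) → a ◁ u ⊎ u ⊏ a
        go (suc k) {p} {a} {u} lt pa uw a⋖e with p Finₚ.≟ u
        ... | yes ≡.refl = inj₂ [ pa ]
        ... | no p≢u with ≤-total (Y u) (Y p)
        ...   | inj₁ u≤p =
          let p′ , p′p = ∃parent (≥⇒≢s u≤p p≢u) in
          Sum.map (◁-⊏ˡ [ pa ]) (_▹ pa) (go k (ℕₚ.<-≤-trans (parent-level p′p) (ℕ.s≤s⁻¹ lt)) p′p uw
            (lowerˡ (parent-edge pa) uw a⋖e u≤p p≢u (inj₂ ≡.refl)))
        ...   | inj₂ p≤u =
          let q , qu = ∃parent (≥⇒≢s p≤u (p≢u ∘ ≡.sym)) in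
          inj₁ (tree-⋖⇒◁ pa qu (lowerʳ (parent-edge pa) uw a⋖e p≤u p≢u (inj₂ ≡.refl)))

      ⋖-tree : ∀ {u w q b} → Edge u w → Parent q b → (u , w) ⋖ (q , b) → u ◁ b ⊎ u ⊏ b
      ⋖-tree {q = q} = go (suc (level q)) ℕₚ.≤-refl
        where
        go : ∀ k {u w q b} → level q ℕ.< k → Edge u w → Parent q b → (u , w) ⋖ (q , b) → u ◁ b ⊎ u ⊏ b
        go (suc k) {u} {w} {q} lt uw qb e⋖b with u Finₚ.≟ q
        ... | yes ≡.refl = inj₂ [ qb ]
        ... | no u≢q with ≤-total (Y u) (Y q)
        ...   | inj₁ u≤q =
          let q′ , q′q = ∃parent (≥⇒≢s u≤q (u≢q ∘ ≡.sym)) in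
          Sum.map (◁-⊏ʳ [ qb ]) (_▹ qb) (go k (ℕₚ.<-≤-trans (parent-level q′q) (ℕ.s≤s⁻¹ lt)) uw q′q
            (lowerʳ uw (parent-edge qb) e⋖b u≤q u≢q (inj₂ ≡.refl)))
        ...   | inj₂ q≤u =
          let p , pu = ∃parent (≥⇒≢s q≤u u≢q) in
          inj₁ (tree-⋖⇒◁ pu qb (lowerˡ uw (parent-edge qb) e⋖b q≤u u≢q (inj₂ ≡.refl)))

      -- The parent edge of the higher tail replaces its arc, so one of the two arcs may be assumed
      -- to lie in the tree.
      ⋖-tails : ∀ {u w v a} → Edge u w → Edge v a → (u , w) ⋖ (v , a) → u ≡ v ⊎ u ⊏ v ⊎ v ⊏ u ⊎ u ◁ v
      ⋖-tails {u} {w} {v} uw va e⋖f with u Finₚ.≟ v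
      ... | yes u≡v = inj₁ u≡v
      ... | no u≢v with ≤-total (Y u) (Y v)
      ...   | inj₁ u≤v =
        let q , qv = ∃parent (≥⇒≢s u≤v (u≢v ∘ ≡.sym)) in
        [ inj₂ ∘ inj₂ ∘ inj₂ , inj₂ ∘ inj₁ ]′ (⋖-tree uw qv (lowerʳ uw va e⋖f u≤v u≢v (inj₂ ≡.refl)))
      ...   | inj₂ v≤u =
        let p , pu = ∃parent (≥⇒≢s v≤u u≢v) in
        [ inj₂ ∘ inj₂ ∘ inj₂ , inj₂ ∘ inj₂ ∘ inj₁ ]′ (tree-⋖ pu va (lowerˡ uw va e⋖f v≤u u≢v (inj₂ ≡.refl)))

      ⋖⇒¬▷ : ∀ {u w v a} → Edge u w → Edge v a → v ◁ u → ¬ (u , w) ⋖ (v , a)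
      ⋖⇒¬▷ uw va v◁u e⋖f with ⋖-tails uw va e⋖f
      ... | inj₁ ≡.refl              = ◁-irrefl v◁u
      ... | inj₂ (inj₁ u⊏v)          = ◁⇒¬⊐ v◁u u⊏v
      ... | inj₂ (inj₂ (inj₁ v⊏u))   = ◁⇒¬⊏ v◁u v⊏u
      ... | inj₂ (inj₂ (inj₂ u◁v))   = ◁-asym u◁v v◁u

      -- Descend from `a` to its lowest ancestor that is not below `b`. If this is not `b`, its
      -- parent edge passes `b` on one side, and that side decides between left and right.
      trichotomy-≥ : ∀ k {a b} → level a ℕ.< k → Y b ≤ Y a → a ≢ b → Trichotomy a b
      trichotomy-≥ (suc k) {a} {b} lt b≤a a≢b with ∃parent (≥⇒≢s b≤a a≢b)
      ... | p , pa with p Finₚ.≟ b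
      ...   | yes ≡.refl = descendant [ pa ]
      ...   | no p≢b with ≤-<-connex (Y b) (Y p)
      ...     | inj₂ p<b =
        let q , qb = ∃parent (≥⇒≢s (inj₁ p<b) (p≢b ∘ ≡.sym)) in
        [ (λ o → right (tree-⋖⇒◁ qb pa o)) , (λ o → left (tree-⋖⇒◁ pa qb o)) ]′
          (⋖-connex (parent-edge qb) (parent-edge pa) (inj₂ ≡.refl) (inj₁ p<b , b≤a , p≢b ∘ ≡.sym , a≢b ∘ ≡.sym))
      ...     | inj₁ b≤p with trichotomy-≥ k (ℕₚ.<-≤-trans (parent-level pa) (ℕ.s≤s⁻¹ lt)) b≤p p≢b
      ...       | ancestor p⊏b   = ⊥-elim (<⇒≱ (⊏⇒Y< p⊏b) b≤p)
      ...       | descendant b⊏p = descendant (b⊏p ▹ pa)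
      ...       | left p◁b       = left (◁-⊏ˡ [ pa ] p◁b)
      ...       | right b◁p      = right (◁-⊏ʳ [ pa ] b◁p)

      converse : ∀ {a b} → Trichotomy a b → Trichotomy b a
      converse (ancestor a⊏b)   = descendant a⊏b
      converse (descendant b⊏a) = ancestor b⊏a
      converse (left a◁b)       = right a◁b
      converse (right b◁a)      = left b◁a

      trichotomy : ∀ {a b} → a ≢ b → Trichotomy a b
      trichotomy {a} {b} a≢b =
        [ (λ b≤a → trichotomy-≥ (suc (level a)) ℕₚ.≤-refl b≤a a≢b)
        , (λ a≤b → converse (trichotomy-≥ (suc (level b)) ℕₚ.≤-refl a≤b (a≢b ∘ ≡.sym))) ]′ (≤-total (Y b) (Y a))

    parent-leftmost : ∀ {p u v} → Parent p v → Edge u v → u ≢ p → (p , v) ⋖ (u , v)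
    parent-leftmost {p} {u} {v} pv uv u≢p = ⋖-in (parent-edge pv) uv (first (𝒫 v) pv)
      where
      first : ∀ us → List.head us ≡ just p → position p us ℕ.< position u us
      first (_ ∷ us) ≡.refl with p Finₚ.≟ p | u Finₚ.≟ p
      ... | no p≢p | _       = ⊥-elim (p≢p ≡.refl)
      ... | yes _  | yes u≡p = ⊥-elim (u≢p u≡p)
      ... | yes _  | no _    = ℕ.s≤s ℕ.z≤n

    ⊏-through-parent : ∀ {u p v} → Parent p v → u ⊏ v → u ≡ p ⊎ u ⊏ p
    ⊏-through-parent pv [ uv ] with ≡.refl ← ≡.trans (≡.sym uv) pv = inj₁ ≡.refl
    ⊏-through-parent pv (up ▹ p′v) with ≡.refl ← ≡.trans (≡.sym p′v) pv = inj₂ up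

    nontree-¬⊏ : ∀ {u w p} → Edge u w → Parent p w → u ≢ p → ¬ u ⊏ w
    nontree-¬⊏ uw pw u≢p u⊏w with ⊏-through-parent pw u⊏w
    ... | inj₁ u≡p = u≢p u≡p
    ... | inj₂ u⊏p = no-detour uw (⊏⇒plus u⊏p) (_ , parent-edge pw , ε)

    -- The parent edge of `w` is the leftmost one into `w`, so the tree path to `w` stays to the
    -- left of `u` or passes through `u`; the latter would make `uw` transitive. Ranks therefore
    -- increase along tree edges and decrease along all others.
    nontree-◁ : ∀ {u w p} → Edge u w → Parent p w → u ≢ p → w ◁ u
    nontree-◁ uw pw u≢p =
      [ id , ⊥-elim ∘ nontree-¬⊏ uw pw u≢p ]′ (tree-⋖ pw uw (parent-leftmost pw uw u≢p))

    head≢s : ∀ {u w} → Edge u w → w ≢ s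
    head≢s uw = ≥⇒≢s (inj₁ (rising uw)) λ { ≡.refl → <-irrefl refl (rising uw) }

    -- The tree path to `b` passes the height of `a` to the right of `a`, since otherwise `b` would
    -- not be right of `a` in the tree. At that height `(v , a)` lies left of the path, and `⋖-tree`
    -- locates `v`.
    tail-◁ : ∀ {v a b} → Edge v a → Y a ≤ Y b → a ◁ b → v ◁ b ⊎ v ⊏ b
    tail-◁ {b = b} = go (suc (level b)) ℕₚ.≤-refl
      where
      go : ∀ k {v a b} → level b ℕ.< k → Edge v a → Y a ≤ Y b → a ◁ b → v ◁ b ⊎ v ⊏ b
      go (suc k) {v} {a} {b} lt va a≤b a◁b with ∃parent (≥⇒≢s a≤b λ { ≡.refl → ◁-irrefl a◁b })
      ... | q , qb with q Finₚ.≟ a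
      ...   | yes ≡.refl = ⊥-elim (◁⇒¬⊏ a◁b [ qb ])
      ...   | no q≢a with ≤-<-connex (Y a) (Y q)
      ...     | inj₁ a≤q with trichotomy (q≢a ∘ ≡.sym)
      ...       | ancestor a⊏q   = ⊥-elim (◁⇒¬⊏ a◁b (a⊏q ▹ qb))
      ...       | descendant q⊏a = ⊥-elim (<⇒≱ (⊏⇒Y< q⊏a) a≤q)
      ...       | right q◁a      = ⊥-elim (◁-asym a◁b (◁-⊏ˡ [ qb ] q◁a))
      ...       | left a◁q       = Sum.map (◁-⊏ʳ [ qb ]) (_▹ qb)
        (go k (ℕₚ.<-≤-trans (parent-level qb) (ℕ.s≤s⁻¹ lt)) va a≤q a◁q)
      go (suc k) {v} {a} {b} lt va a≤b a◁b | q , qb | no q≢a | inj₂ q<a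
        with ⋖-connex va (parent-edge qb) (inj₂ ≡.refl) (inj₁ q<a , a≤b , q≢a ∘ ≡.sym , (λ { ≡.refl → ◁-irrefl a◁b }))
      ... | inj₁ f⋖b = ⋖-tree va qb f⋖b
      ... | inj₂ b⋖f =
        let p , pa = ∃parent (head≢s va) in
        ⊥-elim (◁-asym a◁b (tree-⋖⇒◁ qb pa (⋖-transferʳ va (parent-edge qb) (inj₂ ≡.refl) (inj₂ ≡.refl)
          (inj₁ q<a , a≤b , q≢a ∘ ≡.sym , (λ { ≡.refl → ◁-irrefl a◁b })) b⋖f)))

    tail-▷ : ∀ {v a b} → Edge v a → Y a ≤ Y b → b ◁ a → b ◁ v ⊎ v ⊏ b
    tail-▷ {b = b} = go (suc (level b)) ℕₚ.≤-refl
      where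
      go : ∀ k {v a b} → level b ℕ.< k → Edge v a → Y a ≤ Y b → b ◁ a → b ◁ v ⊎ v ⊏ b
      go (suc k) {v} {a} {b} lt va a≤b b◁a with ∃parent (≥⇒≢s a≤b λ { ≡.refl → ◁-irrefl b◁a })
      ... | q , qb with q Finₚ.≟ a
      ...   | yes ≡.refl = ⊥-elim (◁⇒¬⊐ b◁a [ qb ])
      ...   | no q≢a with ≤-<-connex (Y a) (Y q)
      ...     | inj₁ a≤q with trichotomy q≢a
      ...       | ancestor q⊏a   = ⊥-elim (<⇒≱ (⊏⇒Y< q⊏a) a≤q)
      ...       | descendant a⊏q = ⊥-elim (◁⇒¬⊐ b◁a (a⊏q ▹ qb))
      ...       | right a◁q      = ⊥-elim (◁-asym b◁a (◁-⊏ʳ [ qb ] a◁q))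
      ...       | left q◁a       = Sum.map (◁-⊏ˡ [ qb ]) (_▹ qb)
        (go k (ℕₚ.<-≤-trans (parent-level qb) (ℕ.s≤s⁻¹ lt)) va a≤q q◁a)
      go (suc k) {v} {a} {b} lt va a≤b b◁a | q , qb | no q≢a | inj₂ q<a
        with ⋖-connex va (parent-edge qb) (inj₂ ≡.refl) (inj₁ q<a , a≤b , q≢a ∘ ≡.sym , (λ { ≡.refl → ◁-irrefl b◁a }))
      ... | inj₂ b⋖f = tree-⋖ qb va b⋖f
      ... | inj₁ f⋖b =
        let p , pa = ∃parent (head≢s va) in
        ⊥-elim (◁-asym b◁a (tree-⋖⇒◁ pa qb (⋖-transferˡ va (parent-edge qb) (inj₂ ≡.refl) (inj₂ ≡.refl)
          (inj₁ q<a , a≤b , q≢a ∘ ≡.sym , (λ { ≡.refl → ◁-irrefl b◁a })) f⋖b)))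

-- Ranks and directed paths in a reduced graph.

module RankProperties (ℝ : RealNumbers) where

  open RealNumbers ℝ
  open Plane ℝ
  open OrderedField ℝ
  open Ranks ℝ

  module LeftTreeRank (𝒢 : PlaneSTGraph) (Γ : PlaneSTGraph.UpwardPlanarDrawing 𝒢) (reduced : PlaneSTGraph.Reduced 𝒢) where

    open PlaneSTGraph 𝒢
    open LeftTreeGeometry 𝒢 Γ reduced

    ⊏⇒star : ∀ {a b} → a ⊏ b → Star Edge a b
    ⊏⇒star = plus⇒star ∘ ⊏⇒plus

    rank-injective : ∀ {u v} → rank u ≡ rank v → u ≡ v
    rank-injective {u} {v} eq with u Finₚ.≟ v
    ... | yes u≡v = u≡v
    ... | no u≢v with trichotomy u≢v
    ...   | ancestor u⊏v   = ⊥-elim (ℕₚ.<⇒≢ (⊏⇒rank< u⊏v) eq)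
    ...   | descendant v⊏u = ⊥-elim (ℕₚ.<⇒≢ (⊏⇒rank< v⊏u) (≡.sym eq))
    ...   | left u◁v       = ⊥-elim (ℕₚ.<⇒≢ (◁⇒rank< u◁v) eq)
    ...   | right v◁u      = ⊥-elim (ℕₚ.<⇒≢ (◁⇒rank< v◁u) (≡.sym eq))

    -- Phrased through the outgoing arcs of `v`, because `⋖` compares arcs and not vertices.
    LeftOf : Arc → Vertex → Set
    LeftOf e v = Spans e v × (∀ {a} → Edge v a → (v , a) ⋖ e)

    -- Every upward path from a vertex enclosed between the tree path to w and
    -- the arc (u , w), extended below by the tree path to u, ends in w.
    enclosed⇒star : ∀ {u w} → Edge u w → w ◁ u → ∀ v →
                    Y v < Y w → w ◁ v → v ◁ u ⊎ LeftOf (u , w) v → Star Edge v w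
    enclosed⇒star {u} {w} uw w◁u = height-induction _ step
      where
      step : ∀ v → (∀ {a} → Y v < Y a → Y a < Y w → w ◁ a → a ◁ u ⊎ LeftOf (u , w) a → Star Edge a w) →
             Y v < Y w → w ◁ v → v ◁ u ⊎ LeftOf (u , w) v → Star Edge v w
      step v ih v<w w◁v side with ∃successor (λ { ≡.refl → <⇒≱ v<w (star-≤ (reaches-t w)) })
      ... | a , va with a Finₚ.≟ w
      ...   | yes ≡.refl = va ◅ ε
      ...   | no a≢w with ≤-<-connex (Y w) (Y a)
      -- The arc passes the height of `w`. To the right of `w` it would contradict `side`; to the
      -- left of `w` it is left of the parent edge of `w`, which leaves only that `v` is an ancestor
      -- of `w`.
      ...     | inj₁ w≤a =
        [ ⊥-elim ∘ not-right
        , (λ f⋖e → [ ⊥-elim ∘ ◁-asym w◁v , ⊏⇒star ]′ (⋖-tree va pw (⋖-transferʳ uw va (inj₂ ≡.refl) (inj₂ ≡.refl) w-spanned f⋖e)))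
        ]′ (⋖-connex uw va (inj₂ ≡.refl) w-spanned)
        where
        pw = proj₂ (∃parent (head≢s uw))
        w-spanned : Spans (v , a) w
        w-spanned = inj₁ v<w , w≤a , (λ { ≡.refl → ◁-irrefl w◁v }) , a≢w ∘ ≡.sym
        not-right : ¬ (u , w) ⋖ (v , a)
        not-right e⋖f = [ (λ v◁u → ⋖⇒¬▷ uw va v◁u e⋖f) , (λ v-left → ⋖-asym va uw (proj₂ v-left va) e⋖f) ]′ side
      ...     | inj₂ a<w with trichotomy (a≢w ∘ ≡.sym)
      ...       | ancestor w⊏a   = ⊥-elim (<⇒≱ (⊏⇒Y< w⊏a) (inj₁ a<w))
      ...       | descendant a⊏w = va ◅ ⊏⇒star a⊏w
      ...       | right a◁w      = [ ⊥-elim ∘ ◁-asym w◁v , ⊏⇒star ]′ (tail-◁ va (inj₁ a<w) a◁w)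
      ...       | left w◁a with a Finₚ.≟ u
      ...         | yes ≡.refl = va ◅ uw ◅ ε
      ...         | no a≢u with ≤-<-connex (Y u) (Y a)
      -- The arc `(v , a)` cannot cross `(u , w)`, so `a` inherits the second form of the invariant.
      ...           | inj₁ u≤a =
        [ (λ f⋖e → va ◅ ih (rising va) a<w w◁a (inj₂ (a-spanned , λ ab → ⋖-transferˡ va uw (inj₂ ≡.refl) (inj₁ ≡.refl) a-spanned f⋖e)))
        , ⊥-elim ∘ not-right
        ]′ (⋖-connex va uw (inj₂ ≡.refl) a-spanned)
        where
        a-spanned : Spans (u , w) a
        a-spanned = u≤a , inj₁ a<w , a≢u , a≢w
        not-right : ¬ (u , w) ⋖ (v , a)
        not-right e⋖f = [ (λ v◁u → ⋖⇒¬▷ uw va v◁u e⋖f) , (λ v-left → ⋖-asym va uw (proj₂ v-left va) e⋖f) ]′ side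
      ...           | inj₂ a<u with side
      ...             | inj₂ ((u≤v , _) , _) = ⊥-elim (<⇒≱ (<-trans (rising va) a<u) u≤v)
      ...             | inj₁ v◁u with trichotomy a≢u
      ...               | ancestor a⊏u   = va ◅ ⊏⇒star a⊏u ◅◅ (uw ◅ ε)
      ...               | descendant u⊏a = ⊥-elim (<⇒≱ (⊏⇒Y< u⊏a) (inj₁ a<u))
      ...               | left a◁u       = va ◅ ih (rising va) a<w w◁a (inj₁ a◁u)
      ...               | right u◁a      =
        [ ⊥-elim ∘ ◁-asym v◁u , (λ v⊏u → ⊏⇒star v⊏u ◅◅ (uw ◅ ε)) ]′ (tail-▷ va (inj₁ a<u) u◁a)

    -- An arc from `u` further left would either pass `w` on the left, hence to the left of its
    -- parent edge, or end in a vertex `c` from which a path leads to `w`, so that `uw` would be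
    -- transitive.
    nontree-leftmost : ∀ {u w b c} → Edge u w → Parent b w → u ≢ b → Edge u c → ¬ (u , c) ⋖ (u , w)
    nontree-leftmost {u} {w} {b} {c} uw bw u≢b uc c⋖w with c Finₚ.≟ w | ≤-<-connex (Y w) (Y c)
    ... | yes ≡.refl | _ = ⋖-asym uw uw c⋖w c⋖w
    ... | no c≢w | inj₁ w≤c =
      [ ◁-asym (nontree-◁ uw bw u≢b) , nontree-¬⊏ uw bw u≢b ]′
        (⋖-tree uc bw (⋖-transferʳ uw uc (inj₂ ≡.refl) (inj₂ ≡.refl)
          (inj₁ (rising uw) , w≤c , (λ { ≡.refl → <-irrefl refl (rising uw) }) , c≢w ∘ ≡.sym) c⋖w))
    ... | no c≢w | inj₂ c<w with trichotomy (c≢w ∘ ≡.sym)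
    ...   | ancestor w⊏c   = <⇒≱ (⊏⇒Y< w⊏c) (inj₁ c<w)
    ...   | descendant c⊏w = no-detour uw (c , uc , ε) (⊏⇒plus c⊏w)
    ...   | right c◁w      = [ ◁-asym (nontree-◁ uw bw u≢b) , nontree-¬⊏ uw bw u≢b ]′ (tail-◁ uc (inj₁ c<w) c◁w)
    ...   | left w◁c       = no-detour uw (c , uc , ε) (star⇒plus c≢w
      (enclosed⇒star uw (nontree-◁ uw bw u≢b) c c<w w◁c
        (inj₂ (c-spanned , λ cd → ⋖-transferˡ uc uw (inj₂ ≡.refl) (inj₁ ≡.refl) c-spanned c⋖w))))
      where
      c-spanned : Spans (u , w) c
      c-spanned = inj₁ (rising uc) , inj₁ c<w , (λ { ≡.refl → <-irrefl refl (rising uc) }) , c≢w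

    -- By `nontree-leftmost`, `b` is a child of `v`, while `a` is a child further left or the head
    -- of a nontree arc, hence left of `v`. So `b` is the heaviest of the three vertices.
    ⋖-out⇒rank< : ∀ {v a b} → Edge v a → Edge v b → (v , a) ⋖ (v , b) → rank v ℕ.< rank b × rank a ℕ.< rank b
    ⋖-out⇒rank< {v} {a} {b} va vb a⋖b with ∃parent (head≢s va) | ∃parent (head≢s vb)
    ... | p , pa | q , qb with v Finₚ.≟ q | v Finₚ.≟ p
    ...   | no v≢q     | _          = ⊥-elim (nontree-leftmost vb qb v≢q va a⋖b)
    ...   | yes ≡.refl | yes ≡.refl = parent-rank qb , ◁⇒rank< (tree-⋖⇒◁ pa qb a⋖b)
    ...   | yes ≡.refl | no v≢p     = parent-rank qb , ℕₚ.<-trans (◁⇒rank< (nontree-◁ va pa v≢p)) (parent-rank qb)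

    -- The leftmost arc into `v` is its parent edge, and the other tails lie to the right of `v`. No
    -- two of these are on one tree path, since one of their arcs would be transitive.
    ⋖-in⇒rank< : ∀ {v a b} → Edge a v → Edge b v → (a , v) ⋖ (b , v) → rank v ℕ.< rank b × rank a ℕ.< rank b
    ⋖-in⇒rank< {v} {a} {b} av bv a⋖b with ∃parent (head≢s av)
    ... | p , pv with b Finₚ.≟ p | a Finₚ.≟ p
    ...   | yes ≡.refl | yes ≡.refl = ⊥-elim (⋖-asym av av a⋖b a⋖b)
    ...   | yes ≡.refl | no a≢p     = ⊥-elim (⋖-asym av bv a⋖b (parent-leftmost pv av a≢p))
    ...   | no b≢p     | yes ≡.refl = v<b , ℕₚ.<-trans (parent-rank pv) v<b
      where v<b = ◁⇒rank< (nontree-◁ bv pv b≢p)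
    ...   | no b≢p     | no a≢p     = ◁⇒rank< (nontree-◁ bv pv b≢p) , a<b (⋖-tails av bv a⋖b)
      where
      a<b : a ≡ b ⊎ a ⊏ b ⊎ b ⊏ a ⊎ a ◁ b → rank a ℕ.< rank b
      a<b (inj₁ ≡.refl)              = ⊥-elim (⋖-asym av av a⋖b a⋖b)
      a<b (inj₂ (inj₁ a⊏b))          = ⊥-elim (no-detour av (⊏⇒plus a⊏b) (_ , bv , ε))
      a<b (inj₂ (inj₂ (inj₁ b⊏a)))   = ⊥-elim (no-detour bv (⊏⇒plus b⊏a) (_ , av , ε))
      a<b (inj₂ (inj₂ (inj₂ a◁b)))   = ◁⇒rank< a◁b

    Adjacent : Rel Vertex _
    Adjacent p q = Edge p q ⊎ Edge q p

    -- For a tree edge, such a `v` lies in the subtree of the tail. For a nontree edge, `v` is a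
    -- descendant of the head, an ancestor of the tail, or between the two; in the last case
    -- `tail-◁` forces it below the head, where it is enclosed.
    between⇒comparable : ∀ {p q v} → Adjacent p q → rank p ℕ.< rank v → rank v ℕ.< rank q → Star Edge v p ⊎ Star Edge p v
    between⇒comparable {u} {w} {v} (inj₁ uw) u<v v<w with ∃parent (head≢s uw)
    ... | b , bw with u Finₚ.≟ b
    ...   | no u≢b     = ⊥-elim (ℕₚ.<-asym (ℕₚ.<-trans u<v v<w) (◁⇒rank< (nontree-◁ uw bw u≢b)))
    ...   | yes ≡.refl with trichotomy {u} {v} (λ { ≡.refl → ℕₚ.<-irrefl ≡.refl u<v })
    ...     | ancestor u⊏v   = inj₂ (⊏⇒star u⊏v)
    ...     | descendant v⊏u = inj₁ (⊏⇒star v⊏u)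
    ...     | left u◁v       = ⊥-elim (ℕₚ.<-asym v<w (◁⇒rank< (◁-⊏ˡ [ bw ] u◁v)))
    ...     | right v◁u      = ⊥-elim (ℕₚ.<-asym u<v (◁⇒rank< v◁u))
    between⇒comparable {w} {u} {v} (inj₂ uw) w<v v<u with ∃parent (head≢s uw)
    ... | b , bw with u Finₚ.≟ b
    ...   | yes ≡.refl = ⊥-elim (ℕₚ.<-asym (ℕₚ.<-trans w<v v<u) (parent-rank bw))
    ...   | no u≢b with trichotomy {w} {v} (λ { ≡.refl → ℕₚ.<-irrefl ≡.refl w<v })
    ...     | ancestor w⊏v   = inj₂ (⊏⇒star w⊏v)
    ...     | descendant v⊏w = inj₁ (⊏⇒star v⊏w)
    ...     | right v◁w      = ⊥-elim (ℕₚ.<-asym w<v (◁⇒rank< v◁w))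
    ...     | left w◁v with trichotomy {v} {u} (λ { ≡.refl → ℕₚ.<-irrefl ≡.refl v<u })
    ...       | ancestor v⊏u   = inj₁ (⊏⇒star v⊏u ◅◅ (uw ◅ ε))
    ...       | descendant u⊏v = ⊥-elim (ℕₚ.<-asym v<u (⊏⇒rank< u⊏v))
    ...       | right u◁v      = ⊥-elim (ℕₚ.<-asym v<u (◁⇒rank< u◁v))
    ...       | left v◁u with ≤-<-connex (Y w) (Y v)
    ...         | inj₁ w≤v = ⊥-elim ([ ◁-asym v◁u , ◁⇒¬⊐ v◁u ]′ (tail-◁ uw w≤v w◁v))
    ...         | inj₂ v<w = inj₁ (enclosed⇒star uw (nontree-◁ uw bw u≢b) v v<w w◁v (inj₁ v◁u))

    rank-≢ : ∀ {u v} → u ≢ v → rank u ℕ.< rank v ⊎ rank v ℕ.< rank u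
    rank-≢ {u} {v} u≢v with ℕₚ.<-cmp (rank u) (rank v)
    ... | tri< lt _ _ = inj₁ lt
    ... | tri≈ _ eq _ = ⊥-elim (u≢v (rank-injective eq))
    ... | tri> _ _ gt = inj₂ gt

    -- An end of `uw` with larger rank than `p` lies between `p` and `z`, hence is comparable with
    -- `p`. If `p` itself lies between `u` and `w`, the edge `uw` serves for the other end. Since
    -- `p` cannot be on a path from `u` to `w`, it is below or above the whole edge.
    separated : ∀ {u w p z} → Edge u w → Adjacent p z → p ≢ u → p ≢ w →
                rank u ℕ.< rank z → rank w ℕ.< rank z → rank p ℕ.< rank u ⊎ rank p ℕ.< rank w →
                Star Edge p u ⊎ Star Edge w p
    separated {u} {w} {p} {z} uw pz p≢u p≢w u<z w<z p< with rank-≢ {u} {w} (λ { ≡.refl → <-irrefl refl (rising uw) })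
    ... | inj₁ u<w with between⇒comparable pz p<w w<z
      where p<w = [ (λ p<u → ℕₚ.<-trans p<u u<w) , id ]′ p<
    ...   | inj₁ w⇝p = inj₂ w⇝p
    ...   | inj₂ p⇝w = inj₁ ([ (λ p<u → [ no-middle , id ]′ (between⇒comparable pz p<u u<z))
                             , (λ u<p → [ id , no-middle ]′ (between⇒comparable (inj₁ uw) u<p p<w)) ]′ (rank-≢ p≢u))
      where
      p<w = [ (λ p<u → ℕₚ.<-trans p<u u<w) , id ]′ p<
      no-middle : Star Edge u p → Star Edge p u
      no-middle u⇝p = ⊥-elim (no-detour uw (star⇒plus (p≢u ∘ ≡.sym) u⇝p) (star⇒plus p≢w p⇝w))
    separated {u} {w} {p} {z} uw pz p≢u p≢w u<z w<z p< | inj₂ w<u with between⇒comparable pz p<u u<z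
      where p<u = [ id , (λ p<w → ℕₚ.<-trans p<w w<u) ]′ p<
    ...   | inj₂ p⇝u = inj₁ p⇝u
    ...   | inj₁ u⇝p = inj₂ ([ (λ p<w → [ id , no-middle ]′ (between⇒comparable pz p<w w<z))
                             , (λ w<p → [ no-middle , id ]′ (between⇒comparable (inj₂ uw) w<p p<u)) ]′ (rank-≢ p≢w))
      where
      p<u = [ id , (λ p<w → ℕₚ.<-trans p<w w<u) ]′ p<
      no-middle : Star Edge p w → Star Edge w p
      no-middle p⇝w = ⊥-elim (no-detour uw (star⇒plus (p≢u ∘ ≡.sym) u⇝p) (star⇒plus p≢w p⇝w))

-- Horizontal steps.

module Horizontal (ℝ : RealNumbers) where

  open RealNumbers ℝ
  open Plane ℝ
  open OrderedField ℝ
  open Segments ℝ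
  open Trees ℝ

  abstract
    mix-sub : ∀ a b c d t → mix a b t - mix c d t ≈ mix (a - c) (b - d) t
    mix-sub = solve 5 (λ a b c d t → ((con 1ℤ :- t) :* a :+ t :* b) :- ((con 1ℤ :- t) :* c :+ t :* d) := (con 1ℤ :- t) :* (a :- c) :+ t :* (b :- d)) refl

    mix-*ʳ : ∀ a b t c → mix a b t * c ≈ mix (a * c) (b * c) t
    mix-*ʳ = solve 4 (λ a b t c → ((con 1ℤ :- t) :* a :+ t :* b) :* c := (con 1ℤ :- t) :* (a :* c) :+ t :* (b :* c)) refl

    mix-*ˡ : ∀ a b t c → c * mix a b t ≈ mix (c * a) (c * b) t
    mix-*ˡ = solve 4 (λ a b t c → c :* ((con 1ℤ :- t) :* a :+ t :* b) := (con 1ℤ :- t) :* (c :* a) :+ t :* (c :* b)) refl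

    -- With `c < d` the difference would be a convex combination of positive numbers. Hence points
    -- in a fixed weak order that differ at the start can meet only if they coincide at the end.
    mix-equal : ∀ {a b c d t} → UnitInterval t → a < b → c ≤ d → mix a c t ≈ mix b d t → c ≈ d
    mix-equal t∈ a<b (inj₂ c≈d) eq = c≈d
    mix-equal {a} {b} {c} {d} {t} (0≤t , t≤1) a<b (inj₁ c<d) eq = ⊥-elim (<-irrefl eq
      (<-by ((1# - t) * (b - a) + t * (d - c)) (positive t≤1) (trans (mix-sub b d a c t) refl)))
      where
      positive : t ≤ 1# → 0# < (1# - t) * (b - a) + t * (d - c)
      positive (inj₁ t<1) = 0<+≤ (0<* (0<-sub t<1) (0<-sub a<b)) (0≤* 0≤t (inj₁ (0<-sub c<d)))
      positive (inj₂ t≈1) = <-respʳ (+-comm _ _)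
        (0<+≤ (0<* (<-respʳ (sym t≈1) 0<1) (0<-sub c<d)) (0≤* (0≤-sub (inj₂ t≈1)) (inj₁ (0<-sub a<b))))

    rising⇒upward : ∀ {𝒢 : PlaneSTGraph} (Δ : Placement (PlaneSTGraph.graph 𝒢)) → let open PlaneSTGraph 𝒢 in
                    (∀ {u v} → Edge u v → y (Δ u) < y (Δ v)) → Upward graph Δ
    rising⇒upward Δ rise u v uv s t _ _ s<t = mix-mono (rise uv) s<t

  module _ (𝒢 : PlaneSTGraph) (Γ : PlaneSTGraph.UpwardPlanarDrawing 𝒢) where

    open PlaneSTGraph 𝒢
    open STDrawing 𝒢 Γ

    module _ (Δ : Placement graph) (rise : ∀ {u v} → Edge u v → y (Δ u) < y (Δ v)) (planar : Planar graph Δ) where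

      private
        star-mono : ∀ {u v} → Star Edge u v → y (Δ u) ≤ y (Δ v)
        star-mono ε        = ≤-refl
        star-mono (e ◅ es) = ≤-trans (inj₁ (rise e)) (star-mono es)

        higher⇒≢s : ∀ {u v} → y (Δ v) ≤ y (Δ u) → u ≢ v → u ≢ s
        higher⇒≢s {u} {v} v≤u u≢v ≡.refl with s-reaches v
        ... | ε      = u≢v ≡.refl
        ... | e ◅ es = <⇒≱ (<-≤-trans (rise e) (star-mono es)) v≤u

      -- Two coinciding vertices are not lower than each other, so neither is the source and both
      -- have parent edges. These meet there, and planarity makes the point a common end, which can
      -- only be the head of both.
      planar⇒isDrawing : IsDrawing graph Δ
      planar⇒isDrawing u v (x≈ , y≈) with u Finₚ.≟ v
      ... | yes u≡v = u≡v
      ... | no u≢v with ∃parent (higher⇒≢s (inj₂ (sym y≈)) u≢v) | ∃parent (higher⇒≢s (inj₂ y≈) (u≢v ∘ ≡.sym))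
      ...   | p , pu | q , qv with planar p u q v (parent-edge pu) (parent-edge qv) (u≢v ∘ proj₂) (Δ u)
                                 (onSegment-end _ _) (onSegment-resp ≈ₚ-refl ≈ₚ-refl (sym x≈ , sym y≈) (onSegment-end _ _))
      ...     | c , inj₁ ≡.refl , _           , _ , y≈c = ⊥-elim (<-irrefl (sym y≈c) (rise (parent-edge pu)))
      ...     | c , inj₂ ≡.refl , inj₁ ≡.refl , _       = ⊥-elim (<-irrefl y≈ (rise (parent-edge qv)))
      ...     | c , inj₂ ≡.refl , inj₂ ≡.refl , _       = ≡.refl

  module SameHeights (𝒢 : PlaneSTGraph) (Γ₀ Γ₁ : PlaneSTGraph.UpwardPlanarDrawing 𝒢) where

    open PlaneSTGraph 𝒢

    private
      module A = STDrawing 𝒢 Γ₀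
      module B = STDrawing 𝒢 Γ₁

    module _ (same-height : ∀ v → A.Y v ≈ B.Y v) where

      private
        spans : ∀ {e v} → A.Spans e v → B.Spans e v
        spans (u≤v , v≤w , v≢u , v≢w) = transfer u≤v , transfer v≤w , v≢u , v≢w
          where
          transfer : ∀ {u v} → A.Y u ≤ A.Y v → B.Y u ≤ B.Y v
          transfer u≤v = ≤-trans (inj₂ (sym (same-height _))) (≤-trans u≤v (inj₂ (same-height _)))

      abstract
        -- Equal heights mean equal spans, so both drawings can be traced down along the same edges
        -- until the arcs leave a common vertex, where the shared list `𝒮` decides.
        same-order : ∀ {u w v a} → Edge u w → Edge v a → (u , w) A.⋖ (v , a) → ¬ (v , a) B.⋖ (u , w)
        same-order {u} {v = v} = go (suc (A.level u ℕ.+ A.level v)) ℕₚ.≤-refl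
          where
          go : ∀ k {u w v a} → A.level u ℕ.+ A.level v ℕ.< k → Edge u w → Edge v a →
               (u , w) A.⋖ (v , a) → ¬ (v , a) B.⋖ (u , w)
          go (suc k) {u} {w} {v} {a} lt uw va o₀ o₁ with u Finₚ.≟ v
          ... | yes ≡.refl = ℕₚ.<-asym (A.⋖-out⁻¹ uw va o₀) (B.⋖-out⁻¹ va uw o₁)
          ... | no u≢v with ≤-total (A.Y v) (A.Y u)
          ...   | inj₁ v≤u =
            let p , pu = A.∃parent (A.≥⇒≢s v≤u u≢v)
                u-spanned = v≤u , A.⋖-heightˡ uw va o₀ , u≢v , A.⋖⇒tail≢head uw va o₀
            in go k (ℕₚ.<-≤-trans (ℕₚ.+-monoˡ-< (A.level v) (A.level-< (A.rising (A.parent-edge pu)))) (ℕ.s≤s⁻¹ lt)) (A.parent-edge pu) va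
                 (A.⋖-transferˡ uw va (inj₁ ≡.refl) (inj₂ ≡.refl) u-spanned o₀)
                 (B.⋖-transferʳ uw va (inj₁ ≡.refl) (inj₂ ≡.refl) (spans u-spanned) o₁)
          ...   | inj₂ u≤v =
            let q , qv = A.∃parent (A.≥⇒≢s u≤v (u≢v ∘ ≡.sym))
                v-spanned = u≤v , A.⋖-heightʳ uw va o₀ , u≢v ∘ ≡.sym , A.⋖⇒head≢tail uw va o₀ ∘ ≡.sym
            in go k (ℕₚ.<-≤-trans (ℕₚ.+-monoʳ-< (A.level u) (A.level-< (A.rising (A.parent-edge qv)))) (ℕ.s≤s⁻¹ lt)) uw (A.parent-edge qv)
                 (A.⋖-transferʳ va uw (inj₁ ≡.refl) (inj₂ ≡.refl) v-spanned o₀)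
                 (B.⋖-transferˡ va uw (inj₁ ≡.refl) (inj₂ ≡.refl) (spans v-spanned) o₁)

      module _ {t : Carrier} (t∈ : UnitInterval t) where

        private
          module E₀ = HasEmbedding (proj₂ Γ₀)
          module E₁ = HasEmbedding (proj₂ Γ₁)

          Δ : Placement graph
          Δ v = interpolate (A.P v) (B.P v) t

          abstract
            Δ-height : ∀ v → y (Δ v) ≈ A.Y v
            Δ-height v = trans (mix-cong t refl (sym (same-height v))) (mix-idem _ t)

            Δ-rising : ∀ {u v} → Edge u v → y (Δ u) < y (Δ v)
            Δ-rising uv = <-respˡ (sym (Δ-height _)) (<-respʳ (sym (Δ-height _)) (A.rising uv))

            mix-interchange : ∀ a b c d s t → mix (mix a b t) (mix c d t) s ≈ mix (mix a c s) (mix b d s) t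
            mix-interchange = solve 6 (λ a b c d s t →
              (con 1ℤ :- s) :* ((con 1ℤ :- t) :* a :+ t :* b) :+ s :* ((con 1ℤ :- t) :* c :+ t :* d) :=
              (con 1ℤ :- t) :* ((con 1ℤ :- s) :* a :+ s :* c) :+ t :* ((con 1ℤ :- s) :* b :+ s :* d)) refl

            heights₀ : ∀ {u w p s} → y p ≈ mix (y (Δ u)) (y (Δ w)) s → y p ≈ mix (A.Y u) (A.Y w) s
            heights₀ ey = trans ey (mix-cong _ (Δ-height _) (Δ-height _))

            heights₁ : ∀ {u w p s} → y p ≈ mix (y (Δ u)) (y (Δ w)) s → y p ≈ mix (B.Y u) (B.Y w) s
            heights₁ {p = p} ey = trans (heights₀ {p = p} ey) (mix-cong _ (same-height _) (same-height _))

            Δ-planar : Planar graph Δ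
            Δ-planar u w v a uw va e≢f p (s₀ , s₀∈ , ex , ey) (s₁ , s₁∈ , ex′ , ey′) =
              meet (compare (x p₀) (x q₀))
              where
              p₀ p₁ q₀ q₁ : Point
              p₀ = interpolate (A.P u) (A.P w) s₀
              p₁ = interpolate (B.P u) (B.P w) s₀
              q₀ = interpolate (A.P v) (A.P a) s₁
              q₁ = interpolate (B.P v) (B.P a) s₁

              y₀≈ : y p₀ ≈ y q₀
              y₀≈ = trans (sym (heights₀ {p = p} ey)) (heights₀ {p = p} ey′)
              y₁≈ : y p₁ ≈ y q₁
              y₁≈ = trans (sym (heights₁ {p = p} ey)) (heights₁ {p = p} ey′)

              x≈ : mix (x p₀) (x p₁) t ≈ mix (x q₀) (x q₁) t
              x≈ = trans (sym (trans ex (mix-interchange _ _ _ _ s₀ t))) (trans ex′ (mix-interchange _ _ _ _ s₁ t))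

              Goal : Set
              Goal = ∃[ c ] (c ≡ u ⊎ c ≡ w) × (c ≡ v ⊎ c ≡ a) × p ≈ₚ Δ c

              at-vertex : ∀ {c} → c ≡ u ⊎ c ≡ w → c ≡ v ⊎ c ≡ a → y p ≈ A.Y c → Goal
              at-vertex {c} c∈e c∈f yp≈ = c , c∈e , c∈f ,
                onSegment-unique (Δ-rising uw) (s₀ , s₀∈ , ex , ey) (end c∈e) yp≈Δ , yp≈Δ
                where
                yp≈Δ : y p ≈ y (Δ c)
                yp≈Δ = trans yp≈ (sym (Δ-height c))
                end : c ≡ u ⊎ c ≡ w → OnSegment (Δ u) (Δ w) (Δ c)
                end (inj₁ ≡.refl) = onSegment-start _ _
                end (inj₂ ≡.refl) = onSegment-end _ _

              meet₀ : x p₀ ≈ x q₀ → Goal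
              meet₀ x₀≈ = found (IsUpwardPlanarDrawing.planar E₀.isUpwardPlanarDrawing u w v a uw va e≢f p₀
                  (s₀ , s₀∈ , ≈ₚ-refl) (s₁ , s₁∈ , x₀≈ , y₀≈))
                where
                found : (∃[ c ] (c ≡ u ⊎ c ≡ w) × (c ≡ v ⊎ c ≡ a) × p₀ ≈ₚ A.P c) → Goal
                found (c , c∈e , c∈f , _ , yc) = at-vertex c∈e c∈f (trans (heights₀ {p = p} ey) yc)

              meet₁ : x p₁ ≈ x q₁ → Goal
              meet₁ x₁≈ = found (IsUpwardPlanarDrawing.planar E₁.isUpwardPlanarDrawing u w v a uw va e≢f p₁
                  (s₀ , s₀∈ , ≈ₚ-refl) (s₁ , s₁∈ , x₁≈ , y₁≈))
                where
                found : (∃[ c ] (c ≡ u ⊎ c ≡ w) × (c ≡ v ⊎ c ≡ a) × p₁ ≈ₚ B.P c) → Goal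
                found (c , c∈e , c∈f , _ , yc) = at-vertex c∈e c∈f (trans (heights₁ {p = p} ey) (trans yc (sym (same-height c))))

              meet : Tri (x p₀ < x q₀) (x p₀ ≈ x q₀) (x q₀ < x p₀) → Goal
              meet (tri≈ _ x₀≈ _) = meet₀ x₀≈
              -- The order at time 0 persists weakly at time 1, so the two points, equal at time
              -- `t`, already coincide at time 1, and planarity of Γ₁ applies.
              meet (tri< p<q _ _) = meet₁ (mix-equal t∈ p<q (≮⇒≥ λ q<p → same-order uw va
                (p₀ , q₀ , (s₀ , s₀∈ , ≈ₚ-refl) , (s₁ , s₁∈ , ≈ₚ-refl) , y₀≈ , p<q)
                (q₁ , p₁ , (s₁ , s₁∈ , ≈ₚ-refl) , (s₀ , s₀∈ , ≈ₚ-refl) , sym y₁≈ , q<p)) x≈)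
              meet (tri> _ _ q<p) = meet₁ (sym (mix-equal t∈ q<p (≮⇒≥ λ p<q → same-order va uw
                (q₀ , p₀ , (s₁ , s₁∈ , ≈ₚ-refl) , (s₀ , s₀∈ , ≈ₚ-refl) , sym y₀≈ , q<p)
                (p₁ , q₁ , (s₀ , s₀∈ , ≈ₚ-refl) , (s₁ , s₁∈ , ≈ₚ-refl) , y₁≈ , p<q)) (sym x≈)))

            -- With the heights fixed, the bilinear cross product is linear in the abscissae, hence
            -- affine in `t`; a sign common to both ends persists throughout.
            cross-mix : ∀ o q r → cross (Δ o) (Δ q) (Δ r) ≈ mix (cross (A.P o) (A.P q) (A.P r)) (cross (B.P o) (B.P q) (B.P r)) t
            cross-mix o q r = trans
              (+-cong (trans (*-cong (mix-sub _ _ _ _ t) dr) (trans (mix-*ʳ _ _ t _) (mix-cong t refl (*-congˡ (height-difference r o)))))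
                      (-‿cong (trans (*-cong dq (mix-sub _ _ _ _ t)) (trans (mix-*ˡ _ _ t _) (mix-cong t refl (*-congʳ (height-difference q o)))))))
              (mix-sub _ _ _ _ t)
              where
              height-difference : ∀ a b → A.Y a - A.Y b ≈ B.Y a - B.Y b
              height-difference a b = +-cong (same-height a) (-‿cong (same-height b))
              dr : y (Δ r) - y (Δ o) ≈ A.Y r - A.Y o
              dr = +-cong (Δ-height r) (-‿cong (Δ-height o))
              dq : y (Δ q) - y (Δ o) ≈ A.Y q - A.Y o
              dq = +-cong (Δ-height q) (-‿cong (Δ-height o))

            mix-<0 : ∀ {a b} → a < 0# → b < 0# → mix a b t < 0#
            mix-<0 {a} {b} a<0 b<0 with ≤-total a b
            ... | inj₁ a≤b = ≤-<-trans (mix-≤ t∈ a≤b ≤-refl) b<0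
            ... | inj₂ b≤a = ≤-<-trans (mix-≤ t∈ ≤-refl b≤a) a<0

            mix->0 : ∀ {a b} → 0# < a → 0# < b → 0# < mix a b t
            mix->0 {a} {b} 0<a 0<b with ≤-total a b
            ... | inj₁ a≤b = <-≤-trans 0<a (mix-≥ t∈ ≤-refl a≤b)
            ... | inj₂ b≤a = <-≤-trans 0<b (mix-≥ t∈ b≤a ≤-refl)

        horizontal-respects : Respects Δ
        horizontal-respects = record
          { isUpwardPlanarDrawing = record
            { isDrawing = planar⇒isDrawing 𝒢 Γ₀ Δ Δ-rising Δ-planar
            ; planar    = Δ-planar
            ; upward    = rising⇒upward {𝒢} Δ Δ-rising
            }
          ; successors   = λ v → proj₁ (E₀.successors v) ,
              AllPairs.zipWith (λ (c₀ , c₁) → <-respˡ (sym (cross-mix _ _ _)) (mix-<0 c₀ c₁)) (proj₂ (E₀.successors v) , proj₂ (E₁.successors v))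
          ; predecessors = λ v → proj₁ (E₀.predecessors v) ,
              AllPairs.zipWith (λ (c₀ , c₁) → <-respʳ (sym (cross-mix _ _ _)) (mix->0 c₀ c₁)) (proj₂ (E₀.predecessors v) , proj₂ (E₁.predecessors v))
          }

-- Drawings with exponentially growing abscissae.

module Vertical (ℝ : RealNumbers) where

  open RealNumbers ℝ
  open Plane ℝ
  open OrderedField ℝ
  open Segments ℝ
  open Ranks ℝ
  open RankProperties ℝ
  open Horizontal ℝ
  open Algebra.Properties.Semiring.Exp semiring using (_^_)

  module Powers {K : Carrier} (1<K : 1# < K) where

    abstract
      power>0 : ∀ n → 0# < K ^ n
      power>0 zero    = 0<1
      power>0 (suc n) = 0<* (<-trans 0<1 1<K) (power>0 n)

      power-suc : ∀ n → K ^ n < K ^ suc n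
      power-suc n = <-by ((K - 1#) * K ^ n) (0<* (0<-sub 1<K) (power>0 n))
        (solve 2 (λ K p → K :* p :- p := (K :- con 1ℤ) :* p) refl K (K ^ n))

      power-mono : ∀ {m n} → m ℕ.≤ n → K ^ m ≤ K ^ n
      power-mono m≤n = go (ℕₚ.≤⇒≤′ m≤n)
        where
        go : ∀ {m n} → m ℕ.≤′ n → K ^ m ≤ K ^ n
        go (ℕ.≤′-reflexive ≡.refl) = ≤-refl
        go {n = suc n} (ℕ.≤′-step m≤n) = ≤-trans (go m≤n) (inj₁ (power-suc n))

  abstract
    -- M c < δ (b − a) says that b outweighs c by the factor M / δ, which bounds
    -- the ratio of the vertical extents of two arcs.
    outweighs : ∀ {δ M K a b c} → 0# < δ → M < (K - 1#) * δ → 0# < c → a ≤ c → K * c ≤ b → M * c < δ * (b - a)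
    outweighs {δ} {M} {K} {a} {b} {c} 0<δ M<Kδ 0<c a≤c Kc≤b =
      <-by (((K - 1#) * δ - M) * c + (δ * (b - K * c) + δ * (c - a)))
        (0<+≤ (0<* (0<-sub M<Kδ) 0<c) (0≤+ (0≤* (inj₁ 0<δ) (0≤-sub Kc≤b)) (0≤* (inj₁ 0<δ) (0≤-sub a≤c))))
        (solve 6 (λ δ M K a b c → δ :* (b :- a) :- M :* c :=
          ((K :- con 1ℤ) :* δ :- M) :* c :+ (δ :* (b :- K :* c) :+ δ :* (c :- a))) refl δ M K a b c)

    -- The chain is a ℓ′ ≤ c ℓ′ ≤ M c < δ b ≤ ℓ b.
    cross-outweighed : ∀ {δ M a b c ℓ ℓ′} → 0# < δ → M * c < δ * b → 0# ≤ b → a ≤ c → 0# ≤ c → δ ≤ ℓ → ℓ′ ≤ M → δ ≤ ℓ′ → a * ℓ′ < ℓ * b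
    cross-outweighed {δ} {M} {a} {b} {c} {ℓ} {ℓ′} 0<δ Mc<δb 0≤b a≤c 0≤c δ≤ℓ ℓ′≤M δ≤ℓ′ =
      <-by ((δ * b - M * c) + ((ℓ - δ) * b + ((M - ℓ′) * c + ℓ′ * (c - a))))
        (0<+≤ (0<-sub Mc<δb) (0≤+ (0≤* (0≤-sub δ≤ℓ) 0≤b) (0≤+ (0≤* (0≤-sub ℓ′≤M) 0≤c) (0≤* (≤-trans (inj₁ 0<δ) δ≤ℓ′) (0≤-sub a≤c)))))
        (solve 7 (λ δ M a b c ℓ ℓ′ → ℓ :* b :- a :* ℓ′ :=
          (δ :* b :- M :* c) :+ ((ℓ :- δ) :* b :+ ((M :- ℓ′) :* c :+ ℓ′ :* (c :- a)))) refl δ M a b c ℓ ℓ′)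

    mix-displacement : ∀ a b t → mix a b t - a ≈ t * (b - a)
    mix-displacement = solve 3 (λ a b t → ((con 1ℤ :- t) :* a :+ t :* b) :- a := t :* (b :- a)) refl

    mix-displacement′ : ∀ a b t → a - mix a b t ≈ t * (a - b)
    mix-displacement′ = solve 3 (λ a b t → a :- ((con 1ℤ :- t) :* a :+ t :* b) := t :* (a :- b)) refl

    -- At vertical distance d from p along an arc, the horizontal offset is at
    -- most d c / δ, but along the arc towards the heavy end b it is more.
    outrun : ∀ {δ M b c d e τ ℓ} → 0# ≤ τ → e ≈ τ * b → d ≈ τ * ℓ → ℓ ≤ M → 0# ≤ c →
             δ * e ≤ d * c → M * c < δ * b → τ ≈ 0#
    outrun {δ} {M} {b} {c} {d} {e} {τ} {ℓ} (inj₂ 0≈τ) _ _ _ _ _ _ = sym 0≈τ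
    outrun {δ} {M} {b} {c} {d} {e} {τ} {ℓ} (inj₁ 0<τ) e≈ d≈ ℓ≤M 0≤c δe≤dc Mc<δb = ⊥-elim (<⇒≱
      (<-by (τ * ((δ * b - M * c) + (M - ℓ) * c)) (0<* 0<τ (0<+≤ (0<-sub Mc<δb) (0≤* (0≤-sub ℓ≤M) 0≤c)))
        (trans (+-cong (*-congˡ e≈) (-‿cong (*-congʳ d≈)))
          (solve 6 (λ δ M b c τ ℓ → δ :* (τ :* b) :- (τ :* ℓ) :* c := τ :* ((δ :* b :- M :* c) :+ (M :- ℓ) :* c)) refl δ M b c τ ℓ)))
      δe≤dc)

    -- Provides the bound that `outrun` needs when both arcs start at `p`: an arc of extent at least
    -- δ inside a strip of width `c` has horizontal offset at most c / δ per unit of height.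
    gentle : ∀ {δ a b c d e μ ℓ} → 0# ≤ μ → e ≈ μ * (b - a) → d ≈ μ * ℓ → δ ≤ ℓ → 0# ≤ δ → 0# ≤ a → b ≤ c → 0# ≤ c → δ * e ≤ d * c
    gentle {δ} {a} {b} {c} {d} {e} {μ} {ℓ} 0≤μ e≈ d≈ δ≤ℓ 0≤δ 0≤a b≤c 0≤c =
      ≤-by (μ * ((ℓ - δ) * c + (δ * (c - b) + δ * a)))
        (0≤* 0≤μ (0≤+ (0≤* (0≤-sub δ≤ℓ) 0≤c) (0≤+ (0≤* 0≤δ (0≤-sub b≤c)) (0≤* 0≤δ 0≤a))))
        (trans (+-cong (*-congʳ d≈) (-‿cong (*-congˡ e≈)))
          (solve 6 (λ δ a b c μ ℓ → (μ :* ℓ) :* c :- δ :* (μ :* (b :- a)) := μ :* ((ℓ :- δ) :* c :+ (δ :* (c :- b) :+ δ :* a))) refl δ a b c μ ℓ))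

    -- Provides the bound for `outrun` at vertical distance at least δ from `p`: there the width `c`
    -- of the strip already bounds the offset.
    distant : ∀ {δ a b c d} → 0# ≤ δ → 0# ≤ a → b ≤ c → 0# ≤ c → δ ≤ d → δ * (b - a) ≤ d * c
    distant {δ} {a} {b} {c} {d} 0≤δ 0≤a b≤c 0≤c δ≤d =
      ≤-by ((d - δ) * c + (δ * (c - b) + δ * a)) (0≤+ (0≤* (0≤-sub δ≤d) 0≤c) (0≤+ (0≤* 0≤δ (0≤-sub b≤c)) (0≤* 0≤δ 0≤a)))
        (solve 5 (λ δ a b c d → d :* c :- δ :* (b :- a) := (d :- δ) :* c :+ (δ :* (c :- b) :+ δ :* a)) refl δ a b c d)

    mix-at-0 : ∀ {a b t} → t ≈ 0# → mix a b t ≈ a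
    mix-at-0 t≈0 = trans (+-cong (*-congʳ (+-congˡ (-‿cong t≈0))) (*-congʳ t≈0)) (mix-0 _ _)

    sub-via : ∀ {δ a b c} → a ≤ b → δ ≤ c - b → δ ≤ c - a
    sub-via {δ} {a} {b} {c} a≤b δ≤ = ≤-trans δ≤ (≤-by (b - a) (0≤-sub a≤b)
      (solve 3 (λ a b c → (c :- a) :- (c :- b) := b :- a) refl a b c))

    via-sub : ∀ {δ a b c} → b ≤ c → δ ≤ b - a → δ ≤ c - a
    via-sub {δ} {a} {b} {c} b≤c δ≤ = ≤-trans δ≤ (≤-by (c - b) (0≤-sub b≤c)
      (solve 3 (λ a b c → (c :- a) :- (b :- a) := c :- b) refl a b c))

    positive-gap : ∀ {δ a b} → 0# < δ → δ ≤ b - a → a < b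
    positive-gap 0<δ δ≤ = <-by _ (<-≤-trans 0<δ δ≤) refl

  module LeftTreeDrawing
    (𝒢 : PlaneSTGraph) (Γ : PlaneSTGraph.UpwardPlanarDrawing 𝒢) (reduced : PlaneSTGraph.Reduced 𝒢) where

    open PlaneSTGraph 𝒢
    open LeftTreeGeometry 𝒢 Γ reduced
    open LeftTreeRank 𝒢 Γ reduced

    module _ {δ M K : Carrier} (0<δ : 0# < δ) (1<K : 1# < K) (M<Kδ : M < (K - 1#) * δ)
      (Δ : Placement graph) (x≈power : ∀ v → x (Δ v) ≈ K ^ rank v)
      (gap≥ : ∀ {u v} → Edge u v → δ ≤ y (Δ v) - y (Δ u))
      (gap≤ : ∀ {u v} → Edge u v → y (Δ v) - y (Δ u) ≤ M) where

      open Powers 1<K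

      abstract
        rise : ∀ {u v} → Edge u v → y (Δ u) < y (Δ v)
        rise uv = positive-gap 0<δ (gap≥ uv)

        star-rise : ∀ {u v} → Star Edge u v → y (Δ u) ≤ y (Δ v)
        star-rise ε        = ≤-refl
        star-rise (e ◅ es) = ≤-trans (inj₁ (rise e)) (star-rise es)

        plus-gap : ∀ {u v} → Plus u v → δ ≤ y (Δ v) - y (Δ u)
        plus-gap (w , uw , w⇝v) = via-sub (star-rise w⇝v) (gap≥ uw)

        x>0 : ∀ v → 0# < x (Δ v)
        x>0 v = <-respʳ (sym (x≈power v)) (power>0 (rank v))

        x≤power : ∀ {v m} → rank v ℕ.≤ m → x (Δ v) ≤ K ^ m
        x≤power {v} v≤m = ≤-trans (inj₂ (x≈power v)) (power-mono v≤m)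

        power≤x : ∀ {v m} → m ℕ.< rank v → K ^ suc m ≤ x (Δ v)
        power≤x {v} {m} m<v = ≤-trans (power-mono m<v) (inj₂ (sym (x≈power v)))

        x-outweighs : ∀ {p z m} → rank p ℕ.≤ m → m ℕ.< rank z → M * K ^ m < δ * (x (Δ z) - x (Δ p))
        x-outweighs {m = m} p≤m m<z = outweighs 0<δ M<Kδ (power>0 m) (x≤power p≤m) (power≤x m<z)

        x-mono : ∀ {p z} → rank p ℕ.≤ rank z → x (Δ p) ≤ x (Δ z)
        x-mono {p} {z} p≤z = ≤-trans (x≤power p≤z) (inj₂ (sym (x≈power z)))

        -- Away from p the arc (p , z) runs far to the right of (u , w); near p the
        -- arc (u , w) is absent by `separated`, unless p is one of its ends.
        meet-heavy : ∀ {u w p z m π} → Edge u w → Adjacent p z → rank u ℕ.≤ m → rank w ℕ.≤ m → m ℕ.< rank z →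
                     (rank p ℕ.≤ m → rank p ℕ.≤ rank u ⊎ rank p ℕ.≤ rank w) →
                     OnSegment (Δ u) (Δ w) π → OnSegment (Δ p) (Δ z) π → (p ≡ u ⊎ p ≡ w) × π ≈ₚ Δ p
        meet-heavy {u} {w} {p} {z} {m} {π} uw pz u≤m w≤m m<z p≤max (μ , μ∈ , exᵉ , eyᵉ) (τ , τ∈ , ex , ey)
          with ℕₚ.≤-<-connex (rank p) m
        -- Both ends of the heavy arc are at or beyond `K ^ suc m`, while `(u , w)` stays within
        -- `K ^ m`.
        ... | inj₂ m<p = ⊥-elim (<⇒≱ (power-suc m)
          (≤-trans (mix-≥ τ∈ (power≤x m<p) (power≤x m<z)) (≤-trans (inj₂ (sym ex)) (≤-trans (inj₂ exᵉ) (mix-≤ μ∈ (x≤power u≤m) (x≤power w≤m))))))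
        ... | inj₁ p≤m = both-ways pz
          where
          c : Carrier
          c = K ^ m

          0≤c : 0# ≤ c
          0≤c = inj₁ (power>0 m)

          π∈e : OnSegment (Δ u) (Δ w) π
          π∈e = μ , μ∈ , exᵉ , eyᵉ

          u≤π : y (Δ u) ≤ y π
          u≤π = onSegment-y≥ (inj₁ (rise uw)) π∈e

          π≤w : y π ≤ y (Δ w)
          π≤w = onSegment-y≤ (inj₁ (rise uw)) π∈e

          Goal : Set
          Goal = (p ≡ u ⊎ p ≡ w) × π ≈ₚ Δ p

          τ≈0 : ∀ {d ℓ} → d ≈ τ * ℓ → ℓ ≤ M → δ * (x π - x (Δ p)) ≤ d * c → τ ≈ 0#
          τ≈0 d≈ ℓ≤M bound = outrun (proj₁ τ∈) (trans (+-congʳ ex) (mix-displacement _ _ τ)) d≈ ℓ≤M 0≤c bound (x-outweighs p≤m m<z)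

          at-p : τ ≈ 0# → π ≈ₚ Δ p
          at-p eq = trans ex (mix-at-0 eq) , trans ey (mix-at-0 eq)

          -- At vertical distance `d` of at least δ the heavy arc has left the strip: `outrun` would
          -- give τ ≈ 0, hence d ≈ 0.
          apart : ∀ {d ℓ} → d ≈ τ * ℓ → ℓ ≤ M → ¬ δ ≤ d
          apart {d} {ℓ} d≈ ℓ≤M δ≤d = <⇒≱ 0<δ (≤-trans δ≤d (inj₂ (trans d≈ (trans (*-congʳ
            (τ≈0 d≈ ℓ≤M (distant (inj₁ 0<δ) (inj₁ (x>0 p)) (≤-trans (inj₂ exᵉ) (mix-≤ μ∈ (x≤power u≤m) (x≤power w≤m))) 0≤c δ≤d)))
            (zeroˡ ℓ)))))

          level-with : ∀ {q} → q ≡ u ⊎ q ≡ w → y π ≈ y (Δ q) → π ≈ₚ Δ q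
          level-with (inj₁ ≡.refl) eq = onSegment-unique (rise uw) π∈e (onSegment-start _ _) eq , eq
          level-with (inj₂ ≡.refl) eq = onSegment-unique (rise uw) π∈e (onSegment-end _ _) eq , eq

          detached : p ≢ u → p ≢ w → Plus p u ⊎ Plus w p
          detached p≢u p≢w = Sum.map (star⇒plus p≢u) (star⇒plus (p≢w ∘ ≡.sym))
            (separated uw pz p≢u p≢w (ℕₚ.≤-<-trans u≤m m<z) (ℕₚ.≤-<-trans w≤m m<z)
              (Sum.map (λ p≤u → ℕₚ.≤∧≢⇒< p≤u (p≢u ∘ rank-injective)) (λ p≤w → ℕₚ.≤∧≢⇒< p≤w (p≢w ∘ rank-injective)) (p≤max p≤m)))

          both-ways : Adjacent p z → Goal
          both-ways (inj₁ p→z) with p Finₚ.≟ u | p Finₚ.≟ w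
          -- Both arcs rise from `p`, and the heavy one moves right faster at equal heights, so they
          -- meet only in `p`.
          ... | yes ≡.refl | _ = inj₁ ≡.refl , at-p (τ≈0 (trans (+-congʳ ey) (mix-displacement _ _ τ)) (gap≤ p→z)
            (gentle (proj₁ μ∈) (trans (+-congʳ exᵉ) (mix-displacement _ _ μ)) (trans (+-congʳ eyᵉ) (mix-displacement _ _ μ))
              (gap≥ uw) (inj₁ 0<δ) (inj₁ (x>0 u)) (x≤power w≤m) 0≤c))
          ... | no _ | yes ≡.refl = inj₂ ≡.refl , level-with (inj₂ ≡.refl)
            (≤-antisym π≤w (≤-trans (mix-≥ τ∈ ≤-refl (inj₁ (rise p→z))) (inj₂ (sym ey))))
          ... | no p≢u | no p≢w with detached p≢u p≢w
          ...   | inj₁ p⇝u = ⊥-elim (apart (trans (+-congʳ ey) (mix-displacement _ _ τ)) (gap≤ p→z) (via-sub u≤π (plus-gap p⇝u)))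
          ...   | inj₂ w⇝p = ⊥-elim (<⇒≱ (positive-gap 0<δ (plus-gap w⇝p))
            (≤-trans (≤-trans (mix-≥ τ∈ ≤-refl (inj₁ (rise p→z))) (inj₂ (sym ey))) π≤w))
          both-ways (inj₂ z→p) with p Finₚ.≟ u | p Finₚ.≟ w
          ... | yes ≡.refl | _ = inj₁ ≡.refl , level-with (inj₁ ≡.refl)
            (≤-antisym (≤-trans (inj₂ ey) (mix-≤ τ∈ ≤-refl (inj₁ (rise z→p)))) u≤π)
          ... | no _ | yes ≡.refl = inj₂ ≡.refl , at-p (τ≈0 (trans (+-congˡ (-‿cong ey)) (mix-displacement′ _ _ τ)) (gap≤ z→p)
            (gentle (proj₁ (complement μ∈))
              (trans (+-congʳ (trans exᵉ (mix-comm _ _ μ))) (mix-displacement _ _ (1# - μ)))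
              (trans (+-congˡ (-‿cong (trans eyᵉ (mix-comm _ _ μ)))) (mix-displacement′ _ _ (1# - μ)))
              (gap≥ uw) (inj₁ 0<δ) (inj₁ (x>0 w)) (x≤power u≤m) 0≤c))
          ... | no p≢u | no p≢w with detached p≢u p≢w
          ...   | inj₂ w⇝p = ⊥-elim (apart (trans (+-congˡ (-‿cong ey)) (mix-displacement′ _ _ τ)) (gap≤ z→p) (sub-via π≤w (plus-gap w⇝p)))
          ...   | inj₁ p⇝u = ⊥-elim (<⇒≱ (positive-gap 0<δ (plus-gap p⇝u))
            (≤-trans u≤π (≤-trans (inj₂ ey) (mix-≤ τ∈ ≤-refl (inj₁ (rise z→p))))))

        Meeting : Vertex → Vertex → Vertex → Vertex → Point → Set
        Meeting u w v a π = ∃[ c ] (c ≡ u ⊎ c ≡ w) × (c ≡ v ⊎ c ≡ a) × π ≈ₚ Δ c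

        ≤⊔⇒≤ : ∀ k m n → k ℕ.≤ m ℕ.⊔ n → k ℕ.≤ m ⊎ k ℕ.≤ n
        ≤⊔⇒≤ k m n k≤ with ℕₚ.⊔-sel m n
        ... | inj₁ eq = inj₁ (≡.subst (k ℕ.≤_) eq k≤)
        ... | inj₂ eq = inj₂ (≡.subst (k ℕ.≤_) eq k≤)

        meet-lighter : ∀ {u w v a π} → Edge u w → Edge v a → rank u ℕ.⊔ rank w ℕ.< rank v ℕ.⊔ rank a →
                       OnSegment (Δ u) (Δ w) π → OnSegment (Δ v) (Δ a) π → Meeting u w v a π
        meet-lighter {u} {w} {v} {a} uw va lt π∈e π∈f with ℕₚ.⊔-sel (rank v) (rank a)
        ... | inj₂ eq =
          let v∈e , π≈v = meet-heavy uw (inj₁ va) (ℕₚ.m≤m⊔n (rank u) (rank w)) (ℕₚ.m≤n⊔m (rank u) (rank w)) (≡.subst (_ ℕ.<_) eq lt) (≤⊔⇒≤ _ (rank u) (rank w)) π∈e π∈f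
          in v , v∈e , inj₁ ≡.refl , π≈v
        ... | inj₁ eq =
          let a∈e , π≈a = meet-heavy uw (inj₂ va) (ℕₚ.m≤m⊔n (rank u) (rank w)) (ℕₚ.m≤n⊔m (rank u) (rank w)) (≡.subst (_ ℕ.<_) eq lt) (≤⊔⇒≤ _ (rank u) (rank w)) π∈e (onSegment-flip π∈f)
          in a , a∈e , inj₂ ≡.refl , π≈a

        -- The head of the right arc outranks the other two vertices. In `power-planar` this rules
        -- out a tie in which the common heavier end is the tail of both edges.
        out-distinct : ∀ {v a b} → Edge v a → Edge v b → a ≢ b → rank v ℕ.⊔ rank a ≢ rank v ℕ.⊔ rank b
        out-distinct {v} {a} {b} va vb a≢b eq with ℕₚ.<-cmp (position a (𝒮 v)) (position b (𝒮 v))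
        ... | tri≈ _ same _ = a≢b (position-injective (𝒮-∈ va) (𝒮-∈ vb) same)
        ... | tri< lt _ _ = let v<b , a<b = ⋖-out⇒rank< va vb (⋖-out va vb lt) in
          ℕₚ.<⇒≢ (ℕₚ.<-≤-trans (ℕₚ.⊔-lub v<b a<b) (ℕₚ.m≤n⊔m (rank v) (rank b))) eq
        ... | tri> _ _ gt = let v<a , b<a = ⋖-out⇒rank< vb va (⋖-out vb va gt) in
          ℕₚ.<⇒≢ (ℕₚ.<-≤-trans (ℕₚ.⊔-lub v<a b<a) (ℕₚ.m≤n⊔m (rank v) (rank a))) (≡.sym eq)

        in-distinct : ∀ {v a b} → Edge a v → Edge b v → a ≢ b → rank a ℕ.⊔ rank v ≢ rank b ℕ.⊔ rank v
        in-distinct {v} {a} {b} av bv a≢b eq with ℕₚ.<-cmp (position a (𝒫 v)) (position b (𝒫 v))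
        ... | tri≈ _ same _ = a≢b (position-injective (𝒫-∈ av) (𝒫-∈ bv) same)
        ... | tri< lt _ _ = let v<b , a<b = ⋖-in⇒rank< av bv (⋖-in av bv lt) in
          ℕₚ.<⇒≢ (ℕₚ.<-≤-trans (ℕₚ.⊔-lub a<b v<b) (ℕₚ.m≤m⊔n (rank b) (rank v))) eq
        ... | tri> _ _ gt = let v<a , b<a = ⋖-in⇒rank< bv av (⋖-in bv av gt) in
          ℕₚ.<⇒≢ (ℕₚ.<-≤-trans (ℕₚ.⊔-lub b<a v<a) (ℕₚ.m≤m⊔n (rank a) (rank v))) (≡.sym eq)

        consecutive : ∀ {u w a π} → Edge u w → Edge w a → OnSegment (Δ u) (Δ w) π → OnSegment (Δ w) (Δ a) π → π ≈ₚ Δ w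
        consecutive {w = w} {π = π} uw wa π∈e π∈f = onSegment-unique (rise uw) π∈e (onSegment-end _ _) y≈ , y≈
          where
          y≈ : y π ≈ y (Δ w)
          y≈ = ≤-antisym (onSegment-y≤ (inj₁ (rise uw)) π∈e) (onSegment-y≥ (inj₁ (rise wa)) π∈f)

        -- Edges are compared by the rank of their heavier ends. In a tie this end is common, and as
        -- it is not a common tail or a common head, the edges are consecutive.
        power-planar : Planar graph Δ
        power-planar u w v a uw va e≢f π π∈e π∈f with ℕₚ.<-cmp (rank u ℕ.⊔ rank w) (rank v ℕ.⊔ rank a)
        ... | tri< lt _ _ = meet-lighter uw va lt π∈e π∈f
        ... | tri> _ _ gt = let c , c∈f , c∈e , π≈c = meet-lighter va uw gt π∈f π∈e in c , c∈e , c∈f , π≈c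
        ... | tri≈ _ eq _ with ℕₚ.⊔-sel (rank u) (rank w) | ℕₚ.⊔-sel (rank v) (rank a)
        ...   | inj₁ ≡u | inj₁ ≡v with ≡.refl ← rank-injective {u} {v} (≡.trans (≡.sym ≡u) (≡.trans eq ≡v)) =
          ⊥-elim (out-distinct uw va (λ w≡a → e≢f (≡.refl , w≡a)) eq)
        ...   | inj₂ ≡w | inj₂ ≡a with ≡.refl ← rank-injective {w} {a} (≡.trans (≡.sym ≡w) (≡.trans eq ≡a)) =
          ⊥-elim (in-distinct uw va (λ u≡v → e≢f (u≡v , ≡.refl)) eq)
        ...   | inj₁ ≡u | inj₂ ≡a with ≡.refl ← rank-injective {u} {a} (≡.trans (≡.sym ≡u) (≡.trans eq ≡a)) =
          u , inj₁ ≡.refl , inj₂ ≡.refl , consecutive va uw π∈f π∈e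
        ...   | inj₂ ≡w | inj₁ ≡v with ≡.refl ← rank-injective {w} {v} (≡.trans (≡.sym ≡w) (≡.trans eq ≡v)) =
          w , inj₂ ≡.refl , inj₁ ≡.refl , consecutive uw va π∈e π∈f

        cross-ranks : ∀ {v a b ℓ ℓ′} → rank v ℕ.< rank b × rank a ℕ.< rank b → δ ≤ ℓ → δ ≤ ℓ′ → ℓ′ ≤ M →
                      (x (Δ a) - x (Δ v)) * ℓ′ < ℓ * (x (Δ b) - x (Δ v))
        cross-ranks {v} {a} {b} (v<b , a<b) δ≤ℓ δ≤ℓ′ ℓ′≤M = cross-outweighed 0<δ
          (x-outweighs (ℕₚ.m≤m⊔n (rank v) (rank a)) (ℕₚ.⊔-lub v<b a<b)) (0≤-sub (x-mono (ℕₚ.<⇒≤ v<b)))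
          (≤-trans (≤-by (x (Δ v)) (inj₁ (x>0 v)) (solve 2 (λ a v → a :- (a :- v) := v) refl _ _)) (x≤power (ℕₚ.m≤n⊔m (rank v) (rank a))))
          (inj₁ (power>0 (rank v ℕ.⊔ rank a))) δ≤ℓ ℓ′≤M δ≤ℓ′

        cross-out : ∀ {v a b} → Edge v a → Edge v b → (v , a) ⋖ (v , b) → cross (Δ v) (Δ a) (Δ b) < 0#
        cross-out va vb a⋖b = <-by _ (0<-sub (cross-ranks (⋖-out⇒rank< va vb a⋖b) (gap≥ va) (gap≥ vb) (gap≤ vb)))
          (solve 2 (λ p q → con 0ℤ :- (p :- q) := q :- p) refl _ _)

        cross-in : ∀ {v a b} → Edge a v → Edge b v → (a , v) ⋖ (b , v) → 0# < cross (Δ v) (Δ a) (Δ b)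
        cross-in av bv a⋖b = <-by _ (0<-sub (cross-ranks (⋖-in⇒rank< av bv a⋖b) (gap≥ av) (gap≥ bv) (gap≤ bv)))
          (solve 5 (λ A B v a b → (A :* (b :- v) :- (a :- v) :* B) :- con 0ℤ := (v :- a) :* B :- A :* (v :- b)) refl _ _ _ _ _)

      power-respects : Respects Δ
      power-respects = record
        { isUpwardPlanarDrawing = record
          { isDrawing = planar⇒isDrawing 𝒢 Γ Δ rise power-planar
          ; planar    = power-planar
          ; upward    = rising⇒upward {𝒢} Δ rise
          }
        ; successors   = λ v → proj₁ (E.successors v) ,
            allPairs-mapWith∈ (λ a∈ b∈ c → cross-out (𝒮-edge a∈) (𝒮-edge b∈) (cross⇒⋖-out (𝒮-edge a∈) (𝒮-edge b∈) c)) (proj₂ (E.successors v))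
        ; predecessors = λ v → proj₁ (E.predecessors v) ,
            allPairs-mapWith∈ (λ a∈ b∈ c → cross-in (𝒫-edge a∈) (𝒫-edge b∈) (cross⇒⋖-in (𝒫-edge a∈) (𝒫-edge b∈) c)) (proj₂ (E.predecessors v))
        }
        where module E = HasEmbedding (proj₂ Γ)

-- The constants and the three steps.

module ThreeSteps (ℝ : RealNumbers) where

  open RealNumbers ℝ
  open Plane ℝ
  open OrderedField ℝ
  open Segments ℝ
  open Arcs ℝ
  open Ranks ℝ
  open Horizontal ℝ
  open Vertical ℝ
  open Algebra.Properties.Semiring.Exp semiring using (_^_)

  abstract
    finite-bound₂ : ∀ {n} (f : Fin n → Fin n → Carrier) → ∃[ M ] 0# < M × (∀ i j → f i j ≤ M)
    finite-bound₂ f = Product.map₂ (Product.map₂ λ rows≤M i j → ≤-trans (proj₂ (proj₂ (finite-bound (f i))) j) (rows≤M i))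
      (finite-bound (λ i → proj₁ (finite-bound (f i))))

  -- The lower bound is stored as its reciprocal: `finite-bound` then yields it as an upper bound,
  -- and those of two drawings combine by addition.
  record ExtentBounds (𝒢 : PlaneSTGraph) (Γ : PlaneSTGraph.UpwardPlanarDrawing 𝒢) : Set where
    open PlaneSTGraph 𝒢
    field
      upper lower⁻¹   : Carrier
      upper>0         : 0# < upper
      lower⁻¹>0       : 0# < lower⁻¹
      extent≤upper    : ∀ {u v} → Edge u v → y (proj₁ Γ v) - y (proj₁ Γ u) ≤ upper
      1≤lower⁻¹*extent : ∀ {u v} → Edge u v → 1# ≤ lower⁻¹ * (y (proj₁ Γ v) - y (proj₁ Γ u))

  extentBounds : ∀ 𝒢 Γ → ExtentBounds 𝒢 Γ
  extentBounds 𝒢 Γ = record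
    { upper            = proj₁ U
    ; lower⁻¹          = proj₁ L
    ; upper>0          = proj₁ (proj₂ U)
    ; lower⁻¹>0        = proj₁ (proj₂ L)
    ; extent≤upper     = λ {u} {v} _ → proj₂ (proj₂ U) u v
    ; 1≤lower⁻¹*extent = λ {u} {v} uv → reciprocal-bound uv (edge? u v) (proj₂ (proj₂ L) u v)
    }
    where
    open PlaneSTGraph 𝒢
    open ArcOrder upwardPlaneGraph Γ

    reciprocal : ∀ {u v} → Dec (Edge u v) → Carrier
    reciprocal (yes uv) = proj₁ (inv (0<-sub (rising uv)))
    -- Only edges need a reciprocal; 0 is harmless, as the upper bound is positive anyway.
    reciprocal (no _)   = 0#

    U : ∃[ M ] 0# < M × (∀ u v → Y v - Y u ≤ M)
    U = finite-bound₂ (λ u v → Y v - Y u)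

    L : ∃[ M ] 0# < M × (∀ u v → reciprocal (edge? u v) ≤ M)
    L = finite-bound₂ (λ u v → reciprocal (edge? u v))

    reciprocal-bound : ∀ {u v} → Edge u v → (uv? : Dec (Edge u v)) → ∀ {M} → reciprocal uv? ≤ M → 1# ≤ M * (Y v - Y u)
    reciprocal-bound uv (no ¬uv) _ = ⊥-elim (¬uv uv)
    reciprocal-bound {u} {v} _ (yes uv) {M} i≤M with inv (0<-sub (rising uv))
    ... | i , 0<i , eq = ≤-by ((M - i) * (Y v - Y u)) (0≤* (0≤-sub i≤M) (inj₁ (0<-sub (rising uv))))
      (trans (+-congˡ (-‿cong (sym eq))) (solve 3 (λ M i g → M :* g :- g :* i := (M :- i) :* g) refl M i (Y v - Y u)))

  module _ (𝒢 : PlaneSTGraph) (reduced : PlaneSTGraph.Reduced 𝒢) (Γ₀ Γ₁ : PlaneSTGraph.UpwardPlanarDrawing 𝒢) where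

    open PlaneSTGraph 𝒢
    open LeftTreeGeometry 𝒢 Γ₀ reduced using (rank)
    open LeftTreeDrawing 𝒢 Γ₀ reduced

    private
      module B₀ = ExtentBounds (extentBounds 𝒢 Γ₀)
      module B₁ = ExtentBounds (extentBounds 𝒢 Γ₁)

      y₀ y₁ : Vertex → Carrier
      y₀ v = y (proj₁ Γ₀ v)
      y₁ v = y (proj₁ Γ₁ v)

      -- `M` bounds the extents in both drawings from above, and the reciprocal δ of `N` bounds them
      -- from below. `K` is chosen such that (K - 1) δ = M + 1.
      N M K : Carrier
      N = B₀.lower⁻¹ + B₁.lower⁻¹
      M = B₀.upper + B₁.upper
      K = 1# + (M + 1#) * N

      abstract
        0<N : 0# < N
        0<N = 0<+ B₀.lower⁻¹>0 B₁.lower⁻¹>0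

        0<M : 0# < M
        0<M = 0<+ B₀.upper>0 B₁.upper>0

        1<K : 1# < K
        1<K = <-by ((M + 1#) * N) (0<* (0<+ 0<M 0<1) 0<N) (solve 1 (λ a → (con 1ℤ :+ a) :- con 1ℤ := a) refl ((M + 1#) * N))

      δ : Carrier
      δ = proj₁ (inv 0<N)

      abstract
        0<δ : 0# < δ
        0<δ = proj₁ (proj₂ (inv 0<N))

        Nδ≈1 : N * δ ≈ 1#
        Nδ≈1 = proj₂ (proj₂ (inv 0<N))

        M<Kδ : M < (K - 1#) * δ
        M<Kδ = <-by 1# 0<1 (trans
          (+-congʳ (trans (solve 3 (λ M N δ → ((con 1ℤ :+ (M :+ con 1ℤ) :* N) :- con 1ℤ) :* δ := (M :+ con 1ℤ) :* (N :* δ)) refl M N δ)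
            (trans (*-congˡ Nδ≈1) (*-identityʳ _))))
          (solve 1 (λ M → (M :+ con 1ℤ) :- M := con 1ℤ) refl M))

        δ≤ : ∀ {n n′ g} → n + n′ ≈ N → 0# ≤ n′ → 0# ≤ g → 1# ≤ n * g → δ ≤ g
        δ≤ {n} {n′} {g} n+n′≈N 0≤n′ 0≤g 1≤ng = ≮⇒≥ λ g<δ → <⇒≱
          (<-by (N * (δ - g)) (0<* 0<N (0<-sub g<δ)) (trans (+-congʳ (sym Nδ≈1)) (solve 3 (λ N δ g → N :* δ :- N :* g := N :* (δ :- g)) refl N δ g)))
          (≤-trans 1≤ng (≤-by (n′ * g) (0≤* 0≤n′ 0≤g)
            (trans (+-congʳ (*-congʳ (sym n+n′≈N))) (solve 3 (λ n n′ g → (n :+ n′) :* g :- n :* g := n′ :* g) refl n n′ g))))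

        extent≥0 : ∀ (Γ : UpwardPlanarDrawing) {u v} → Edge u v → 0# ≤ y (proj₁ Γ v) - y (proj₁ Γ u)
        extent≥0 Γ uv = 0≤-sub (inj₁ (ArcOrder.rising upwardPlaneGraph Γ uv))

        gap≥₀ : ∀ {u v} → Edge u v → δ ≤ y₀ v - y₀ u
        gap≥₀ uv = δ≤ refl (inj₁ B₁.lower⁻¹>0) (extent≥0 Γ₀ uv) (B₀.1≤lower⁻¹*extent uv)

        gap≥₁ : ∀ {u v} → Edge u v → δ ≤ y₁ v - y₁ u
        gap≥₁ uv = δ≤ (+-comm _ _) (inj₁ B₀.lower⁻¹>0) (extent≥0 Γ₁ uv) (B₁.1≤lower⁻¹*extent uv)

        gap≤₀ : ∀ {u v} → Edge u v → y₀ v - y₀ u ≤ M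
        gap≤₀ uv = ≤-trans (B₀.extent≤upper uv) (≤-by B₁.upper (inj₁ B₁.upper>0) (solve 2 (λ a b → (a :+ b) :- a := b) refl B₀.upper B₁.upper))

        gap≤₁ : ∀ {u v} → Edge u v → y₁ v - y₁ u ≤ M
        gap≤₁ uv = ≤-trans (B₁.extent≤upper uv) (≤-by B₀.upper (inj₁ B₀.upper>0) (solve 2 (λ a b → (a :+ b) :- b := a) refl B₀.upper B₁.upper))

      powerDrawing : (Vertex → Carrier) → Placement graph
      powerDrawing h v = ⟨ K ^ rank v , h v ⟩

      Λ₁ Λ₂ : UpwardPlanarDrawing
      Λ₁ = powerDrawing y₀ , power-respects 0<δ 1<K M<Kδ (powerDrawing y₀) (λ _ → refl) gap≥₀ gap≤₀
      Λ₂ = powerDrawing y₁ , power-respects 0<δ 1<K M<Kδ (powerDrawing y₁) (λ _ → refl) gap≥₁ gap≤₁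

      -- The abscissae do not move, and the extent of an edge is a convex combination of its extents
      -- at the two ends of the step, so the bounds δ and `M` hold at every time.
      vertical-respects : ∀ {t} → UnitInterval t → Respects (λ v → interpolate (powerDrawing y₀ v) (powerDrawing y₁ v) t)
      vertical-respects {t} t∈ = power-respects 0<δ 1<K M<Kδ _ (λ v → mix-idem _ t)
        (λ uv → ≤-trans (mix-≥ t∈ (gap≥₀ uv) (gap≥₁ uv)) (inj₂ (sym (mix-sub _ _ _ _ t))))
        (λ uv → ≤-trans (inj₂ (mix-sub _ _ _ _ t)) (mix-≤ t∈ (gap≤₀ uv) (gap≤₁ uv)))

    threeStepMorph : Σ (Morph upwardPlaneGraph 3 Γ₀ Γ₁) (λ M → Morph.UpwardPlanar M)
    threeStepMorph = record { Λ = Λ ; start = λ _ → ≈ₚ-refl ; end = λ _ → ≈ₚ-refl } , upwardPlanar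
      where
      Λ : Fin 4 → UpwardPlanarDrawing
      Λ Fin.zero                                = Γ₀
      Λ (Fin.suc Fin.zero)                      = Λ₁
      Λ (Fin.suc (Fin.suc Fin.zero))            = Λ₂
      Λ (Fin.suc (Fin.suc (Fin.suc Fin.zero)))  = Γ₁

      upwardPlanar : ∀ i t → UnitInterval t → Respects (λ v → interpolate (proj₁ (Λ (Fin.inject₁ i)) v) (proj₁ (Λ (Fin.suc i)) v) t)
      upwardPlanar Fin.zero                     t t∈ = SameHeights.horizontal-respects 𝒢 Γ₀ Λ₁ (λ _ → refl) t∈
      upwardPlanar (Fin.suc Fin.zero)           t t∈ = vertical-respects t∈
      upwardPlanar (Fin.suc (Fin.suc Fin.zero)) t t∈ = SameHeights.horizontal-respects 𝒢 Λ₂ Γ₁ (λ _ → refl) t∈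

theorem2 : (ℝ : RealNumbers) → let open Plane ℝ in
    (𝒢 : PlaneSTGraph) → let open PlaneSTGraph 𝒢 in
    Reduced →
    (Γ₀ Γ₁ : UpwardPlanarDrawing) →
    Σ (Morph upwardPlaneGraph 3 Γ₀ Γ₁) (λ M → Morph.UpwardPlanar M)
theorem2 ℝ = ThreeSteps.threeStepMorph ℝ
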